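{- Let $s,t\ge0$ be integers, let $\lambda_1\ge\lambda_2\ge\dots\ge\lambda_s\ge0$ be integers, and let $\epsilon_1,\dots,\epsilon_t$ be nonnegative integers. For integers $k\ge\max(s,t)$ set $\lambda_j=0$ for $s<j\le k$, $\epsilon_j=0$ for $t<j\le k$, and $c_j=k+j-1-\epsilon_j$ for $1\le j\le k$. Then there is a polynomial $Q$ of degree $\le 2\sum_{i=1}^s\lambda_i$ such that for all such $k$, $$\det\bigl((c_i)_{\lambda_j+k-j}\bigr)_{1\le i,j\le k}=(-1)^{k(k-1)/2}\,\Delta(c)\,Q(k).$$
   Context: $(z)_\mu=z(z-1)\cdots(z-\mu+1)$ denotes the descending factorial, with $(z)_0=1$. $\Delta(c)=\prod_{1\le i<j\le k}(c_j-c_i)$. -}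

module Defs where

open import Data.Nat as ℕ using (ℕ; zero; suc; _<?_)
open import Data.Nat.DivMod using () renaming (_/_ to _div_)
open import Data.Integer as ℤ using (ℤ; +_)
open import Data.Fin using (Fin; zero; suc; toℕ; fromℕ<; punchIn)
open import Data.List using (List; []; _∷_; map; foldr; allFin; concatMap)
open import Data.Rational as ℚ using (ℚ)
open import Relation.Nullary using (yes; no)

sumℤ : ∀ n → (Fin n → ℤ) → ℤ
sumℤ n f = foldr ℤ._+_ (+ 0) (map f (allFin n))

sumℕ : ∀ n → (Fin n → ℕ) → ℕ
sumℕ n f = foldr ℕ._+_ 0 (map f (allFin n))

descFact : ℤ → ℕ → ℤ
descFact z zero = + 1
descFact z (suc μ) = descFact z μ ℤ.* (z ℤ.- + μ)

det : ∀ n → (Fin n → Fin n → ℤ) → ℤ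
det zero M = + 1
det (suc n) M =
  sumℤ (suc n) (λ j → (ℤ.- + 1) ℤ.^ toℕ j ℤ.* M zero j
                        ℤ.* det n (λ i j′ → M (suc i) (punchIn j j′)))

vandermonde : ∀ k → (Fin k → ℤ) → ℤ
vandermonde k c =
  foldr ℤ._*_ (+ 1)
    (concatMap (λ i → concatMap (λ j → pair i j) (allFin k)) (allFin k))
  where
  pair : Fin k → Fin k → List ℤ
  pair i j with toℕ i <? toℕ j
  ... | yes _ = (c j ℤ.- c i) ∷ []
  ... | no _ = []

-- extend a sequence a_1..a_n by zeros to a_1..a_k (index j : Fin k is a_{j+1})
extend : ∀ n → (Fin n → ℕ) → ∀ k → Fin k → ℕ
extend n a k j with toℕ j <? n
... | yes p = a (fromℕ< p)
... | no _ = 0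

-- c_j = k + j - 1 - ε_j  (Fin index j0 = j - 1)
cvec : ∀ t → (Fin t → ℕ) → ∀ k → Fin k → ℤ
cvec t ε k j = + (k ℕ.+ toℕ j) ℤ.- + extend t ε k j

theMatrix : ∀ s t → (Fin s → ℕ) → (Fin t → ℕ) → ∀ k → Fin k → Fin k → ℤ
theMatrix s t lam ε k i j =
  descFact (cvec t ε k i) (extend s lam k j ℕ.+ (k ℕ.∸ suc (toℕ j)))

evalPoly : List ℚ → ℚ → ℚ
evalPoly [] x = ℚ.0ℚ
evalPoly (a ∷ as) x = a ℚ.+ x ℚ.* evalPoly as x

toℚ : ℤ → ℚ
toℚ z = z ℚ./ 1

signK : ℕ → ℤ
signK k = (ℤ.- + 1) ℤ.^ ((k ℕ.* (k ℕ.∸ 1)) div 2)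

{-# OPTIONS --safe #-}
-- Put v_i = (z)_{k−i} and P(z) = ∏_i (z − c_i). At the points c_i every (z)_{λ_j+k−j} may be replaced by its
-- remainder modulo P, a combination of v_1, …, v_k. For j > s the column j already is v_j, so column
-- operations turn the determinant into the s × s determinant of the coefficients of v_1, …, v_s in the
-- first s columns, times det((c_i)_{k−j}) = (−1)^{k(k−1)/2} Δ(c).
--
-- By Chu–Vandermonde, ∏_{t<j≤k} (z − (k+j−1)) = (z − (k+t))_{k−t} has coefficients C(k−t,i) (−k−t)_i in the
-- falling factorial basis, polynomial in k of degree 2i, and each of the remaining t factors of P
-- changes them with weights that do not depend on k. The recursion for the remainders of
-- (z)_{m+k−j}, m = 0, 1, …, then shows that the coefficient of v_i is polynomial in k of degree
-- ≤ 2(m + i − j), and these bounds add up to 2 Σ λ_j in every term of the s × s determinant.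
module Submission where

open import Defs
open import Data.Nat as ℕ using (ℕ; zero; suc; z≤n; s≤s)
import Data.Nat.Properties as ℕ
import Data.Nat.Tactic.RingSolver as ℕ
open import Data.Nat.Combinatorics using (_C_; nCk+nC[k+1]≡[n+1]C[k+1]; k>n⇒nCk≡0)
open import Data.Nat.Divisibility using (divides)
open import Data.Nat.DivMod using (_/_; +-distrib-/-∣ˡ; m*n/n≡m)
open import Data.Nat.ListAction using (sum)
open import Data.Integer as ℤ using (ℤ; +_)
import Data.Integer.Properties as ℤ
import Data.Integer.Tactic.RingSolver as ℤ
open import Data.Rational as ℚ using (ℚ; fromℚᵘ)
import Data.Rational.Properties as ℚ
open import Data.Rational.Solver using (module +-*-Solver)
open import Data.Rational.Unnormalised as ℚᵘ using (mkℚᵘ; *≡*)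
import Data.Rational.Unnormalised.Properties as ℚᵘ
open import Data.Fin as Fin using (Fin; zero; suc; toℕ; fromℕ<; punchIn)
import Data.Fin.Properties as Fin
open import Data.List using (List; []; _∷_; [_]; _++_; map; foldr; concatMap; length; tabulate; allFin; applyUpTo; upTo; downFrom)
open import Data.List.Properties using (++-assoc; length-++; length-map; length-tabulate; length-applyUpTo; length-downFrom; map-++; map-tabulate; map-upTo)
open import Data.List.Membership.Propositional using (_∈_)
open import Data.List.Membership.Propositional.Properties using (∈-∃++; ∈-++⁺ʳ; ∈-applyUpTo⁺)
open import Data.List.Relation.Binary.Pointwise as Pointwise using (Pointwise; []; _∷_)
open import Data.List.Relation.Unary.All as All using (All; []; _∷_)
import Data.List.Relation.Unary.All.Properties as All
open import Data.Product using (Σ; Σ-syntax; _×_; _,_; proj₁; proj₂)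
open import Data.Sum using (inj₁; inj₂)
open import Function using (_∘_; id)
open import Relation.Nullary using (Dec; yes; no; contradiction; ¬_)
open import Relation.Binary.PropositionalEquality using (_≡_; refl; sym; trans; cong; cong₂; subst; subst₂; module ≡-Reasoning)

module _ where
  open import Data.Integer using (_+_; _*_; -_; _-_; _^_; 0ℤ; 1ℤ; -1ℤ)
  open import Data.Integer.Properties
  open ≡-Reasoning

  -- Determinants as alternating functions of a list of columns

  0≡a0+b0 : ∀ a b → 0ℤ ≡ a * 0ℤ + b * 0ℤ
  0≡a0+b0 = ℤ.solve-∀

  -- Laplace expansion along the row `φ`. A skipped column is pushed into the argument of `F`, and
  -- the nested subtraction produces the alternating signs.
  laplace : ∀ {B : Set} → (B → ℤ) → (List B → ℤ) → List B → ℤ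
  laplace φ F [] = 0ℤ
  laplace φ F (x ∷ xs) = φ x * F xs - laplace φ (F ∘ (x ∷_)) xs

  -- Zero unless there are as many rows as columns; otherwise linearity in the columns would fail.
  detL : ∀ {B : Set} → List (B → ℤ) → List B → ℤ
  detL [] [] = 1ℤ
  detL [] (_ ∷ _) = 0ℤ
  detL (φ ∷ φs) xs = laplace φ (detL φs) xs

  laplace-cong : ∀ {B : Set} (φ : B → ℤ) {F G : List B → ℤ} → (∀ xs → F xs ≡ G xs) →
                 ∀ xs → laplace φ F xs ≡ laplace φ G xs
  laplace-cong φ e [] = refl
  laplace-cong φ e (x ∷ xs) = cong₂ (λ a b → φ x * a - b) (e xs) (laplace-cong φ (e ∘ (x ∷_)) xs)

  laplace-linear : ∀ {B : Set} (φ : B → ℤ) (a b : ℤ) {F G H : List B → ℤ} →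
                   (∀ xs → F xs ≡ a * G xs + b * H xs) →
                   ∀ xs → laplace φ F xs ≡ a * laplace φ G xs + b * laplace φ H xs
  laplace-linear φ a b e [] = 0≡a0+b0 a b
  laplace-linear φ a b {F} {G} {H} e (x ∷ xs) = begin
    φ x * F xs - laplace φ (F ∘ (x ∷_)) xs
      ≡⟨ cong₂ (λ u w → φ x * u - w) (e xs) (laplace-linear φ a b (e ∘ (x ∷_)) xs) ⟩
    φ x * (a * G xs + b * H xs) - (a * laplace φ (G ∘ (x ∷_)) xs + b * laplace φ (H ∘ (x ∷_)) xs)
      ≡⟨ lem (φ x) a b (G xs) (H xs) _ _ ⟩
    a * (φ x * G xs - laplace φ (G ∘ (x ∷_)) xs) + b * (φ x * H xs - laplace φ (H ∘ (x ∷_)) xs) ∎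
    where
    lem : ∀ p a b g h u v → p * (a * g + b * h) - (a * u + b * v) ≡ a * (p * g - u) + b * (p * h - v)
    lem = ℤ.solve-∀

  -- For pulling scalars out of a determinant: `a` comes from the row and `b` from each of its
  -- minors.
  laplace-map : ∀ {A B C : Set} (h : A → B) (h′ : A → C) (φ : B → ℤ) (ψ : C → ℤ) (a b : ℤ)
                {F : List B → ℤ} {G : List C → ℤ} →
                (∀ x → φ (h x) ≡ a * ψ (h′ x)) → (∀ xs → F (map h xs) ≡ b * G (map h′ xs)) →
                ∀ xs → laplace φ F (map h xs) ≡ a * b * laplace ψ G (map h′ xs)
  laplace-map h h′ φ ψ a b p q [] = sym (*-zeroʳ (a * b))
  laplace-map h h′ φ ψ a b {F} {G} p q (x ∷ xs) = begin
    φ (h x) * F (map h xs) - laplace φ (F ∘ (h x ∷_)) (map h xs)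
      ≡⟨ cong₂ _-_ (cong₂ _*_ (p x) (q xs))
           (laplace-map h h′ φ ψ a b p (q ∘ (x ∷_)) xs) ⟩
    a * ψ (h′ x) * (b * G (map h′ xs)) - a * b * laplace ψ (G ∘ (h′ x ∷_)) (map h′ xs)
      ≡⟨ lem a b _ _ _ ⟩
    a * b * (ψ (h′ x) * G (map h′ xs) - laplace ψ (G ∘ (h′ x ∷_)) (map h′ xs)) ∎
    where
    lem : ∀ a b p g u → a * p * (b * g) - a * b * u ≡ a * b * (p * g - u)
    lem = ℤ.solve-∀

  sumℤ-suc : ∀ n (f : Fin (suc n) → ℤ) → sumℤ (suc n) f ≡ f zero + sumℤ n (f ∘ suc)
  sumℤ-suc n f = cong (λ xs → f zero + foldr _+_ 0ℤ xs)
    (trans (map-tabulate suc f) (sym (map-tabulate id (f ∘ suc))))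

  sumℤ-cong : ∀ n {f g : Fin n → ℤ} → (∀ j → f j ≡ g j) → sumℤ n f ≡ sumℤ n g
  sumℤ-cong zero e = refl
  sumℤ-cong (suc n) {f} {g} e = begin
    sumℤ (suc n) f            ≡⟨ sumℤ-suc n f ⟩
    f zero + sumℤ n (f ∘ suc) ≡⟨ cong₂ _+_ (e zero) (sumℤ-cong n (e ∘ suc)) ⟩
    g zero + sumℤ n (g ∘ suc) ≡⟨ sumℤ-suc n g ⟨
    sumℤ (suc n) g            ∎

  sumℤ-neg : ∀ n (f : Fin n → ℤ) → sumℤ n (-_ ∘ f) ≡ - sumℤ n f
  sumℤ-neg zero f = refl
  sumℤ-neg (suc n) f = begin
    sumℤ (suc n) (-_ ∘ f)           ≡⟨ sumℤ-suc n (-_ ∘ f) ⟩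
    - f zero + sumℤ n (-_ ∘ f ∘ suc) ≡⟨ cong (_+_ (- f zero)) (sumℤ-neg n (f ∘ suc)) ⟩
    - f zero + - sumℤ n (f ∘ suc)    ≡⟨ neg-distrib-+ (f zero) _ ⟨
    - (f zero + sumℤ n (f ∘ suc))    ≡⟨ cong -_ (sumℤ-suc n f) ⟨
    - sumℤ (suc n) f ∎

  laplace-tabulate : ∀ {B : Set} (φ : B → ℤ) n (F : List B → ℤ) (g : Fin (suc n) → B) →
    laplace φ F (tabulate g) ≡
      sumℤ (suc n) (λ j → (- + 1) ^ toℕ j * φ (g j) * F (tabulate (g ∘ punchIn j)))
  laplace-tabulate φ zero F g = lem (φ (g zero)) (F [])
    where
    lem : ∀ a b → a * b - + 0 ≡ + 1 * a * b + + 0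
    lem = ℤ.solve-∀
  laplace-tabulate φ (suc n) F g = begin
    φ (g zero) * F (tabulate (g ∘ suc)) - laplace φ (F ∘ (g zero ∷_)) (tabulate (g ∘ suc))
      ≡⟨ cong₂ (λ a b → a - b) (cong (_* F (tabulate (g ∘ suc))) (sym (*-identityˡ (φ (g zero)))))
           (laplace-tabulate φ n (F ∘ (g zero ∷_)) (g ∘ suc)) ⟩
    term zero - sumℤ (suc n) tail
      ≡⟨ cong (_+_ (term zero)) (sumℤ-neg (suc n) tail) ⟨
    term zero + sumℤ (suc n) (-_ ∘ tail)
      ≡⟨ cong (_+_ (term zero)) (sumℤ-cong (suc n) (λ j → lem ((- + 1) ^ toℕ j) (φ (g (suc j))) _)) ⟩
    term zero + sumℤ (suc n) (term ∘ suc)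
      ≡⟨ sumℤ-suc (suc n) term ⟨
    sumℤ (suc (suc n)) term ∎
    where
    term : Fin (suc (suc n)) → ℤ
    term j = (- + 1) ^ toℕ j * φ (g j) * F (tabulate (g ∘ punchIn j))
    tail : Fin (suc n) → ℤ
    tail j = (- + 1) ^ toℕ j * φ (g (suc j)) * F (g zero ∷ tabulate (g ∘ suc ∘ punchIn j))
    lem : ∀ s a b → - (s * a * b) ≡ (- + 1) * s * a * b
    lem = ℤ.solve-∀

  -- Each entry is a functional `φ i` applied to a column object `g j`, so that from here on columns
  -- can be manipulated as functions of `z`.
  det≡detL : ∀ {B : Set} n (M : Fin n → Fin n → ℤ) (φ : Fin n → B → ℤ) (g : Fin n → B) →
    (∀ i j → M i j ≡ φ i (g j)) → det n M ≡ detL (tabulate φ) (tabulate g)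
  det≡detL zero M φ g e = refl
  det≡detL (suc n) M φ g e = trans
    (sumℤ-cong (suc n) (λ j → cong₂ _*_ (cong ((- + 1) ^ toℕ j *_) (e zero j))
      (det≡detL n _ (φ ∘ suc) (g ∘ punchIn j) (λ i j′ → e (suc i) (punchIn j j′)))))
    (sym (laplace-tabulate (φ zero) n (detL (tabulate (φ ∘ suc))) g))

  -- Linearity is relational, through the values of the rows, as there is no function extensionality.
  record Alternating {B : Set} (φs : List (B → ℤ)) (F : List B → ℤ) : Set where
    field
      linear : ∀ ys zs w a x b y → All (λ φ → φ w ≡ a * φ x + b * φ y) φs →
               F (ys ++ w ∷ zs) ≡ a * F (ys ++ x ∷ zs) + b * F (ys ++ y ∷ zs)
      swap : ∀ ys x y zs → F (ys ++ x ∷ y ∷ zs) ≡ - F (ys ++ y ∷ x ∷ zs)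

  open Alternating

  -- At the swapped pair, the two terms that delete `x` or `y` trade places. In the remaining terms
  -- both survive, and the sign comes from `F`, fed to `laplace-linear` as a combination with
  -- coefficients -1 and 0.
  laplace-swap : ∀ {B : Set} (φ : B → ℤ) {F : List B → ℤ} →
    (∀ ys x y zs → F (ys ++ x ∷ y ∷ zs) ≡ - F (ys ++ y ∷ x ∷ zs)) →
    ∀ ys x y zs → laplace φ F (ys ++ x ∷ y ∷ zs) ≡ - laplace φ F (ys ++ y ∷ x ∷ zs)
  laplace-swap φ {F} sw [] x y zs = begin
    φ x * F (y ∷ zs) - (φ y * F (x ∷ zs) - laplace φ (λ us → F (x ∷ y ∷ us)) zs)
      ≡⟨ cong (λ u → φ x * F (y ∷ zs) - (φ y * F (x ∷ zs) - u))
           (laplace-linear φ -1ℤ 0ℤ {H = λ us → F (y ∷ x ∷ us)}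
             (λ us → trans (sw [] x y us) (lem₁ _)) zs) ⟩
    φ x * F (y ∷ zs) - (φ y * F (x ∷ zs) - (-1ℤ * L + 0ℤ * L))
      ≡⟨ lem₂ (φ x * F (y ∷ zs)) (φ y * F (x ∷ zs)) L ⟩
    - (φ y * F (x ∷ zs) - (φ x * F (y ∷ zs) - L)) ∎
    where
    L = laplace φ (λ us → F (y ∷ x ∷ us)) zs
    lem₁ : ∀ a → - a ≡ -1ℤ * a + 0ℤ * a
    lem₁ = ℤ.solve-∀
    lem₂ : ∀ a b u → a - (b - (-1ℤ * u + 0ℤ * u)) ≡ - (b - (a - u))
    lem₂ = ℤ.solve-∀
  laplace-swap φ {F} sw (w ∷ ys) x y zs = trans
    (cong₂ (λ a b → φ w * a - b) (sw ys x y zs) (laplace-swap φ (sw ∘ (w ∷_)) ys x y zs))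
    (lem (φ w) _ _)
    where
    lem : ∀ p a b → p * - a - - b ≡ - (p * a - b)
    lem = ℤ.solve-∀

  cons : ∀ {B : Set} {φs : List (B → ℤ)} {F} → Alternating φs F → ∀ x → Alternating φs (F ∘ (x ∷_))
  cons A x .linear ys = A .linear (x ∷ ys)
  cons A x .swap ys = A .swap (x ∷ ys)

  laplace-alternating : ∀ {B : Set} (φ : B → ℤ) {φs : List (B → ℤ)} {F} →
    Alternating φs F → Alternating (φ ∷ φs) (laplace φ F)
  laplace-alternating φ A .swap = laplace-swap φ (A .swap)
  laplace-alternating φ {φs} {F} A .linear [] zs w a x b y (e ∷ es) = begin
    φ w * F zs - laplace φ (F ∘ (w ∷_)) zs
      ≡⟨ cong₂ (λ p q → p * F zs - q) e (laplace-linear φ a b (λ us → A .linear [] us w a x b y es) zs) ⟩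
    (a * φ x + b * φ y) * F zs - (a * laplace φ (F ∘ (x ∷_)) zs + b * laplace φ (F ∘ (y ∷_)) zs)
      ≡⟨ lem a b (φ x) (φ y) (F zs) _ _ ⟩
    _ ∎
    where
    lem : ∀ a b p q f u v → (a * p + b * q) * f - (a * u + b * v) ≡ a * (p * f - u) + b * (q * f - v)
    lem = ℤ.solve-∀
  laplace-alternating φ {φs} {F} A .linear (u ∷ ys) zs w a x b y (e ∷ es) = trans
    (cong₂ (λ p q → φ u * p - q) (A .linear ys zs w a x b y es)
      (laplace-alternating φ (cons A u) .linear ys zs w a x b y (e ∷ es)))
    (lem a b (φ u) _ _ _ _)
    where
    lem : ∀ a b p g h u v → p * (a * g + b * h) - (a * u + b * v) ≡ a * (p * g - u) + b * (p * h - v)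
    lem = ℤ.solve-∀

  detL-alternating : ∀ {B : Set} (φs : List (B → ℤ)) → Alternating φs (detL φs)
  detL-alternating [] .linear [] zs _ a _ b _ _ = 0≡a0+b0 a b
  detL-alternating [] .linear (_ ∷ _) zs _ a _ b _ _ = 0≡a0+b0 a b
  detL-alternating [] .swap [] _ _ _ = refl
  detL-alternating [] .swap (_ ∷ _) _ _ _ = refl
  detL-alternating (φ ∷ φs) = laplace-alternating φ (detL-alternating φs)

  append : ∀ {B : Set} {φs : List (B → ℤ)} {F} → Alternating φs F → ∀ rest → Alternating φs (λ xs → F (xs ++ rest))
  append {F = F} A rest .linear ys zs w a x b y e = begin
    F ((ys ++ w ∷ zs) ++ rest)
      ≡⟨ cong F (++-assoc ys (w ∷ zs) rest) ⟩
    F (ys ++ w ∷ zs ++ rest)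
      ≡⟨ A .linear ys (zs ++ rest) w a x b y e ⟩
    a * F (ys ++ x ∷ zs ++ rest) + b * F (ys ++ y ∷ zs ++ rest)
      ≡⟨ cong₂ (λ p q → a * F p + b * F q) (++-assoc ys (x ∷ zs) rest) (++-assoc ys (y ∷ zs) rest) ⟨
    a * F ((ys ++ x ∷ zs) ++ rest) + b * F ((ys ++ y ∷ zs) ++ rest) ∎
  append {F = F} A rest .swap ys x y zs = begin
    F ((ys ++ x ∷ y ∷ zs) ++ rest) ≡⟨ cong F (++-assoc ys (x ∷ y ∷ zs) rest) ⟩
    F (ys ++ x ∷ y ∷ zs ++ rest)   ≡⟨ A .swap ys x y (zs ++ rest) ⟩
    - F (ys ++ y ∷ x ∷ zs ++ rest) ≡⟨ cong (-_ ∘ F) (++-assoc ys (y ∷ x ∷ zs) rest) ⟨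
    - F ((ys ++ y ∷ x ∷ zs) ++ rest) ∎

  i≡-i⇒i≡0 : ∀ i → i ≡ - i → i ≡ 0ℤ
  i≡-i⇒i≡0 (+ zero) e = refl
  i≡-i⇒i≡0 (+ suc n) ()
  i≡-i⇒i≡0 ℤ.-[1+ n ] ()

  adjacent≡0 : ∀ {B : Set} {φs : List (B → ℤ)} {F} → Alternating φs F →
               ∀ ys x zs → F (ys ++ x ∷ x ∷ zs) ≡ 0ℤ
  adjacent≡0 A ys x zs = i≡-i⇒i≡0 _ (A .swap ys x x zs)

  move : ∀ {B : Set} {φs : List (B → ℤ)} {F} → Alternating φs F →
         ∀ x ys zs → F (x ∷ ys ++ zs) ≡ -1ℤ ^ length ys * F (ys ++ x ∷ zs)
  move A x [] zs = sym (*-identityˡ _)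
  move {F = F} A x (y ∷ ys) zs = begin
    F (x ∷ y ∷ ys ++ zs)                            ≡⟨ A .swap [] x y (ys ++ zs) ⟩
    - F (y ∷ x ∷ ys ++ zs)                          ≡⟨ cong -_ (move (cons A y) x ys zs) ⟩
    - (-1ℤ ^ length ys * F (y ∷ ys ++ x ∷ zs))       ≡⟨ lem (-1ℤ ^ length ys) _ ⟩
    -1ℤ * -1ℤ ^ length ys * F (y ∷ ys ++ x ∷ zs) ∎
    where
    lem : ∀ a b → - (a * b) ≡ -1ℤ * a * b
    lem = ℤ.solve-∀

  repeated≡0 : ∀ {B : Set} {φs : List (B → ℤ)} {F} → Alternating φs F →
               ∀ x ys zs → F (x ∷ ys ++ x ∷ zs) ≡ 0ℤ
  repeated≡0 {F = F} A x ys zs = begin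
    F (x ∷ ys ++ x ∷ zs)                   ≡⟨ move A x ys (x ∷ zs) ⟩
    -1ℤ ^ length ys * F (ys ++ x ∷ x ∷ zs) ≡⟨ cong (-1ℤ ^ length ys *_) (adjacent≡0 A ys x zs) ⟩
    -1ℤ ^ length ys * 0ℤ                   ≡⟨ *-zeroʳ (-1ℤ ^ length ys) ⟩
    0ℤ ∎

  -- Expanding columns in a common basis

  Σ< : ℕ → (ℕ → ℤ) → ℤ
  Σ< zero f = 0ℤ
  Σ< (suc n) f = f 0 + Σ< n (f ∘ suc)

  ΣL : ∀ {B : Set} → List B → (B → ℤ) → ℤ
  ΣL [] f = 0ℤ
  ΣL (x ∷ xs) f = f x + ΣL xs f

  ΣL-applyUpTo : ∀ {B : Set} (f : B → ℤ) (g : ℕ → B) n → ΣL (applyUpTo g n) f ≡ Σ< n (f ∘ g)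
  ΣL-applyUpTo f g zero = refl
  ΣL-applyUpTo f g (suc n) = cong (_+_ (f (g 0))) (ΣL-applyUpTo f (g ∘ suc) n)

  Σ<-cong : ∀ n {f g : ℕ → ℤ} → (∀ i → f i ≡ g i) → Σ< n f ≡ Σ< n g
  Σ<-cong zero e = refl
  Σ<-cong (suc n) e = cong₂ _+_ (e 0) (Σ<-cong n (e ∘ suc))

  Σ<-zero : ∀ n {f : ℕ → ℤ} → (∀ {i} → i ℕ.< n → f i ≡ 0ℤ) → Σ< n f ≡ 0ℤ
  Σ<-zero zero e = refl
  Σ<-zero (suc n) e = cong₂ _+_ (e (ℕ.s≤s ℕ.z≤n)) (Σ<-zero n (e ∘ ℕ.s≤s))

  Σ<-+ : ∀ n (f g : ℕ → ℤ) → Σ< n (λ i → f i + g i) ≡ Σ< n f + Σ< n g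
  Σ<-+ zero f g = refl
  Σ<-+ (suc n) f g = trans (cong (_+_ (f 0 + g 0)) (Σ<-+ n (f ∘ suc) (g ∘ suc))) (lem (f 0) (g 0) _ _)
    where
    lem : ∀ p q u v → p + q + (u + v) ≡ p + u + (q + v)
    lem = ℤ.solve-∀

  Σ<-* : ∀ n a (f : ℕ → ℤ) → Σ< n (λ i → a * f i) ≡ a * Σ< n f
  Σ<-* zero a f = sym (*-zeroʳ a)
  Σ<-* (suc n) a f = trans (cong (_+_ (a * f 0)) (Σ<-* n a (f ∘ suc))) (sym (*-distribˡ-+ a (f 0) _))

  Σ<-++ : ∀ m n (f : ℕ → ℤ) → Σ< (m ℕ.+ n) f ≡ Σ< m f + Σ< n (f ∘ (m ℕ.+_))
  Σ<-++ zero n f = sym (+-identityˡ _)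
  Σ<-++ (suc m) n f = trans (cong (_+_ (f 0)) (Σ<-++ m n (f ∘ suc))) (sym (+-assoc (f 0) _ _))

  -- The rows of the matrix become evaluations at the nodes `c_i`, and the columns become functions.
  eval : ℤ → (ℤ → ℤ) → ℤ
  eval c f = f c

  -- The rows see a column only through its values at the nodes, so an expansion valid at the points
  -- of `cs` is enough. This is what permits reduction modulo a polynomial vanishing there.
  linear-Σ< : ∀ {cs F} → Alternating (map eval cs) F → ∀ ys zs w n (a : ℕ → ℤ) (v : ℕ → ℤ → ℤ) →
    All (λ c → w c ≡ Σ< n (λ i → a i * v i c)) cs →
    F (ys ++ w ∷ zs) ≡ Σ< n (λ i → a i * F (ys ++ v i ∷ zs))
  -- An empty sum means that `w` is 0 at every node, so `w` equals `0 · w + 0 · w` there; any column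
  -- could serve as the two summands.
  linear-Σ< A ys zs w zero a v e = A .linear ys zs w 0ℤ w 0ℤ w (All.map⁺ (All.map id e))
  linear-Σ< {F = F} A ys zs w (suc n) a v e = begin
    F (ys ++ w ∷ zs)
      ≡⟨ A .linear ys zs w (a 0) (v 0) 1ℤ tail
           (All.map⁺ (All.map (λ {c} p → trans p (cong (_+_ (a 0 * v 0 c)) (sym (*-identityˡ (tail c))))) e)) ⟩
    a 0 * F (ys ++ v 0 ∷ zs) + 1ℤ * F (ys ++ tail ∷ zs)
      ≡⟨ cong (_+_ (a 0 * F (ys ++ v 0 ∷ zs))) (*-identityˡ (F (ys ++ tail ∷ zs))) ⟩
    a 0 * F (ys ++ v 0 ∷ zs) + F (ys ++ tail ∷ zs)
      ≡⟨ cong (_+_ (a 0 * F (ys ++ v 0 ∷ zs)))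
           (linear-Σ< A ys zs tail n (a ∘ suc) (v ∘ suc) (All.map (λ _ → refl) e)) ⟩
    a 0 * F (ys ++ v 0 ∷ zs) + Σ< n (λ i → a (suc i) * F (ys ++ v (suc i) ∷ zs)) ∎
    where
    tail : ℤ → ℤ
    tail z = Σ< n (λ i → a (suc i) * v (suc i) z)

  ΣL-remove : ∀ {B : Set} (as : List B) x bs (f : B → ℤ) → f x ≡ 0ℤ → ΣL (as ++ x ∷ bs) f ≡ ΣL (as ++ bs) f
  ΣL-remove [] x bs f e = trans (cong (_+ ΣL bs f) e) (+-identityˡ _)
  ΣL-remove (a ∷ as) x bs f e = cong (_+_ (f a)) (ΣL-remove as x bs f e)

  -- w = Σ_{l ∈ ls} T l · v l up to terms annihilated by G, so ls may shrink as columns are fixed.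
  Expands : ∀ {B L : Set} → (List B → ℤ) → (L → B) → List L → (L → ℤ) → B → Set
  Expands G v ls T w = ∀ ys zs → G (ys ++ w ∷ zs) ≡ ΣL ls (λ l → T l * G (ys ++ v l ∷ zs))

  -- Once the column `v l` stands in front, the term of label `l` would repeat it and vanishes, so
  -- `l` drops out of the list.
  Expands-cons : ∀ {B L : Set} {φs : List (B → ℤ)} {G} → Alternating φs G → ∀ (v : L → B) as l bs {T w} →
    Expands G v (as ++ l ∷ bs) T w → Expands (G ∘ (v l ∷_)) v (as ++ bs) T w
  Expands-cons {G = G} A v as l bs {T} e ys zs = trans (e (v l ∷ ys) zs)
    (ΣL-remove as l bs _ (trans (cong (T l *_) (repeated≡0 A (v l) ys zs)) (*-zeroʳ (T l))))

  -- Multiplicativity of determinants for alternating functions: expanding the first column gives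
  -- one term per label, the other columns are expanded in the remaining labels by induction, and
  -- the sum is the Laplace expansion along `T`.
  expand : ∀ {B L : Set} {φs : List (B → ℤ)} {G} → Alternating φs G → (v : L → B) → ∀ ls {Ts ws} →
    Pointwise (Expands G v ls) Ts ws → length ws ≡ length ls → G ws ≡ detL Ts ls * G (map v ls)
  expand A v [] [] _ = sym (*-identityˡ _)
  expand {φs = φs} {G} A v ls {T ∷ Ts} {w ∷ ws} (e ∷ es) len = begin
    G (w ∷ ws)
      ≡⟨ e [] ws ⟩
    ΣL ls (λ l → T l * G (v l ∷ ws))
      ≡⟨ split [] ls es len ⟩
    1ℤ * laplace T (detL Ts) ls * G (map v ls)
      ≡⟨ cong (_* G (map v ls)) (*-identityˡ (laplace T (detL Ts) ls)) ⟩
    laplace T (detL Ts) ls * G (map v ls) ∎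
    where
    lem₀ : ∀ s g → 0ℤ ≡ s * 0ℤ * g
    lem₀ = ℤ.solve-∀
    lem₁ : ∀ s p d g h → p * (d * (s * g)) + -1ℤ * s * h * g ≡ s * (p * d - h) * g
    lem₁ = ℤ.solve-∀
    -- The labels `as` are done and `bs` remain. Moving `v b` back to its place behind the columns
    -- of `as` costs `-1ℤ ^ length as`, which is exactly the sign of `T b` in the expansion.
    split : ∀ as bs → Pointwise (Expands G v (as ++ bs)) Ts ws → suc (length ws) ≡ length (as ++ bs) →
      ΣL bs (λ l → T l * G (v l ∷ ws)) ≡
      -1ℤ ^ length as * laplace T (λ us → detL Ts (as ++ us)) bs * G (map v (as ++ bs))
    split as [] es len = lem₀ (-1ℤ ^ length as) (G (map v (as ++ [])))
    split as (b ∷ bs) es len = trans (cong₂ _+_ (cong (T b *_) first) rest)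
      (lem₁ (-1ℤ ^ length as) (T b) (detL Ts (as ++ bs)) (G (map v (as ++ b ∷ bs))) _)
      where
      assoc : (as ++ [ b ]) ++ bs ≡ as ++ b ∷ bs
      assoc = ++-assoc as [ b ] bs
      first : G (v b ∷ ws) ≡ detL Ts (as ++ bs) * (-1ℤ ^ length as * G (map v (as ++ b ∷ bs)))
      first = begin
        G (v b ∷ ws)
          ≡⟨ expand (cons A (v b)) v (as ++ bs) (Pointwise.map (λ {T′} {w′} → Expands-cons A v as b bs {T′} {w′}) es)
               (ℕ.suc-injective (trans len (trans (length-++ as) (trans (ℕ.+-suc _ _) (cong suc (sym (length-++ as))))))) ⟩
        detL Ts (as ++ bs) * G (v b ∷ map v (as ++ bs))
          ≡⟨ cong (λ us → detL Ts (as ++ bs) * G (v b ∷ us)) (map-++ v as bs) ⟩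
        detL Ts (as ++ bs) * G (v b ∷ map v as ++ map v bs)
          ≡⟨ cong (detL Ts (as ++ bs) *_) (move A (v b) (map v as) (map v bs)) ⟩
        detL Ts (as ++ bs) * (-1ℤ ^ length (map v as) * G (map v as ++ v b ∷ map v bs))
          ≡⟨ cong₂ (λ n us → detL Ts (as ++ bs) * (-1ℤ ^ n * G us)) (length-map v as) (sym (map-++ v as (b ∷ bs))) ⟩
        detL Ts (as ++ bs) * (-1ℤ ^ length as * G (map v (as ++ b ∷ bs))) ∎
      rest : ΣL bs (λ l → T l * G (v l ∷ ws)) ≡
        -1ℤ * -1ℤ ^ length as * laplace T (λ us → detL Ts (as ++ b ∷ us)) bs * G (map v (as ++ b ∷ bs))
      rest = begin
        ΣL bs (λ l → T l * G (v l ∷ ws))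
          ≡⟨ split (as ++ [ b ]) bs
               (subst (λ ls → Pointwise (Expands G v ls) Ts ws) (sym assoc) es)
               (trans len (cong length (sym assoc))) ⟩
        -1ℤ ^ length (as ++ [ b ]) * laplace T (λ us → detL Ts ((as ++ [ b ]) ++ us)) bs * G (map v ((as ++ [ b ]) ++ bs))
          ≡⟨ cong₂ (λ n us → -1ℤ ^ n * laplace T (λ us → detL Ts ((as ++ [ b ]) ++ us)) bs * G (map v us))
               (trans (length-++ as) (ℕ.+-comm _ 1)) assoc ⟩
        -1ℤ ^ suc (length as) * laplace T (λ us → detL Ts ((as ++ [ b ]) ++ us)) bs * G (map v (as ++ b ∷ bs))
          ≡⟨ cong (λ d → -1ℤ ^ suc (length as) * d * G (map v (as ++ b ∷ bs)))
               (laplace-cong T (λ us → cong (detL Ts) (++-assoc as [ b ] us)) bs) ⟩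
        -1ℤ * -1ℤ ^ length as * laplace T (λ us → detL Ts (as ++ b ∷ us)) bs * G (map v (as ++ b ∷ bs)) ∎

  -- The determinant of the falling factorials

  falling : ℕ → ℤ → ℤ
  falling m z = descFact z m

  fallings : ℕ → List (ℤ → ℤ)
  fallings n = map falling (downFrom n)

  shifted : ℤ → ℕ → ℤ → ℤ
  shifted c m z = (z - c) * descFact z m

  -- `(z)_{n+1} = (z − c)(z)_n + (c − n)(z)_n`, and the second summand is a multiple of the next
  -- column. Hence every column except the last can be made divisible by `z − c`.
  column-operations : ∀ c {cs F} → Alternating (map eval cs) F → ∀ n →
    F (fallings (suc n)) ≡ F (map (shifted c) (downFrom n) ++ [ falling 0 ])
  column-operations c A zero = refl
  column-operations c {cs} {F} A (suc n) = begin
    F (falling (suc n) ∷ fallings (suc n))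
      ≡⟨ A .linear [] (fallings (suc n)) (falling (suc n)) 1ℤ (shifted c n) (c - + n) (falling n)
           (All.map⁺ (All.universal (λ z → lem z c (+ n) (descFact z n)) cs)) ⟩
    1ℤ * F (shifted c n ∷ fallings (suc n)) + (c - + n) * F (falling n ∷ fallings (suc n))
      ≡⟨ cong (λ u → 1ℤ * F (shifted c n ∷ fallings (suc n)) + (c - + n) * u)
           (adjacent≡0 A [] (falling n) (fallings n)) ⟩
    1ℤ * F (shifted c n ∷ fallings (suc n)) + (c - + n) * 0ℤ
      ≡⟨ lem′ (c - + n) _ ⟩
    F (shifted c n ∷ fallings (suc n))
      ≡⟨ column-operations c (cons A (shifted c n)) n ⟩
    F (map (shifted c) (downFrom (suc n)) ++ [ falling 0 ]) ∎
    where
    lem : ∀ z c n f → f * (z - n) ≡ 1ℤ * ((z - c) * f) + (c - n) * f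
    lem = ℤ.solve-∀
    lem′ : ∀ a f → 1ℤ * f + a * 0ℤ ≡ f
    lem′ = ℤ.solve-∀

  laplace-last : ∀ {B : Set} (φ : B → ℤ) F {us} v → All (λ u → φ u ≡ 0ℤ) us →
    laplace φ F (us ++ [ v ]) ≡ -1ℤ ^ length us * (φ v * F us)
  laplace-last φ F v [] = lem _
    where
    lem : ∀ a → a - 0ℤ ≡ 1ℤ * a
    lem = ℤ.solve-∀
  laplace-last φ F {u ∷ us} v (e ∷ es) = trans
    (cong₂ (λ a b → a * F (us ++ [ v ]) - b) e (laplace-last φ (F ∘ (u ∷_)) v es))
    (lem (F (us ++ [ v ])) (-1ℤ ^ length us) _)
    where
    lem : ∀ f s a → 0ℤ * f - s * a ≡ -1ℤ * s * a
    lem = ℤ.solve-∀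

  ΠL : ∀ {B : Set} → List B → (B → ℤ) → ℤ
  ΠL [] f = 1ℤ
  ΠL (x ∷ xs) f = f x * ΠL xs f

  detL-shifted : ∀ c cs ms →
    detL (map eval cs) (map (shifted c) ms) ≡ ΠL cs (_- c) * detL (map eval cs) (map falling ms)
  detL-shifted c [] [] = refl
  detL-shifted c [] (_ ∷ _) = refl
  detL-shifted c (z ∷ cs) = laplace-map (shifted c) falling (eval z) (eval z) (z - c) (ΠL cs (_- c))
    (λ _ → refl) (detL-shifted c cs)

  -- The Vandermonde product of the differences `c_j − c_i`, `i < j`, with the sign
  -- `(−1)^{(k−1)+(k−2)+…+0}` built in step by step.
  alternant : List ℤ → ℤ
  alternant [] = 1ℤ
  alternant (c ∷ cs) = -1ℤ ^ length cs * (ΠL cs (_- c) * alternant cs)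

  -- With `c` the first node, the column operations leave the first row zero except for a final 1.
  -- Expanding along it and taking `z − c` out of each remaining row gives the same determinant for
  -- fewer nodes.
  detL-fallings : ∀ cs → detL (map eval cs) (fallings (length cs)) ≡ alternant cs
  detL-fallings [] = refl
  detL-fallings (c ∷ cs) = begin
    detL (map eval (c ∷ cs)) (fallings (suc n))
      ≡⟨ column-operations c {c ∷ cs} (detL-alternating (map eval (c ∷ cs))) n ⟩
    laplace (eval c) (detL (map eval cs)) (map (shifted c) (downFrom n) ++ [ falling 0 ])
      ≡⟨ laplace-last (eval c) (detL (map eval cs)) (falling 0)
           (All.map⁺ (All.universal (λ m → trans (cong (_* descFact c m) (+-inverseʳ c)) refl) (downFrom n))) ⟩
    -1ℤ ^ length (map (shifted c) (downFrom n)) * (1ℤ * detL (map eval cs) (map (shifted c) (downFrom n)))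
      ≡⟨ cong₂ (λ m d → -1ℤ ^ m * d)
           (trans (length-map (shifted c) (downFrom n)) (length-downFrom n))
           (trans (*-identityˡ _) (trans (detL-shifted c cs (downFrom n)) (cong (ΠL cs (_- c) *_) (detL-fallings cs)))) ⟩
    alternant (c ∷ cs) ∎
    where
    n = length cs

  -- Reduction of falling factorials modulo ∏ (z − c_i)

  -- Coefficients are counted down from the highest factorial `(z)_{n−1}`. With this indexing the
  -- position of a coefficient does not depend on `n`, so it can later be studied as a function of
  -- `k`.
  combination : (ℕ → ℤ) → ℕ → ℤ → ℤ
  combination b n z = Σ< n (λ i → b i * descFact z (n ℕ.∸ suc i))

  -- Each term but the last contains the factor `z − n + 1 + i`, by
  -- `(z)_{n−i} = (z − n + 1 + i)(z)_{n−1−i}`.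
  combination-suc : ∀ b n z →
    combination b (suc n) z ≡ combination (λ i → (z - + n + 1ℤ + + i) * b i) n z + b n
  combination-suc b zero z = lem (b 0)
    where
    lem : ∀ a → a * 1ℤ + 0ℤ ≡ 0ℤ + a
    lem = ℤ.solve-∀
  combination-suc b (suc n) z = begin
    b 0 * (f * (z - + n)) + combination (b ∘ suc) (suc n) z
      ≡⟨ cong (_+_ (b 0 * (f * (z - + n)))) (combination-suc (b ∘ suc) n z) ⟩
    b 0 * (f * (z - + n)) + (combination (λ i → (z - + n + 1ℤ + + i) * b (suc i)) n z + b (suc n))
      ≡⟨ cong₂ (λ p q → p + (q + b (suc n))) (lem₁ (b 0) f z (+ n))
           (Σ<-cong n (λ i → cong (λ p → p * b (suc i) * descFact z (n ℕ.∸ suc i)) (lem₂ z (+ n) (+ i)))) ⟩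
    head + (tail + b (suc n))
      ≡⟨ +-assoc head tail (b (suc n)) ⟨
    head + tail + b (suc n) ∎
    where
    f = descFact z n
    head = (z - + suc n + 1ℤ + 0ℤ) * b 0 * f
    tail = combination (λ i → (z - + suc n + 1ℤ + + suc i) * b (suc i)) n z
    lem₁ : ∀ b f z n → b * (f * (z - n)) ≡ (z - (1ℤ + n) + 1ℤ + 0ℤ) * b * f
    lem₁ = ℤ.solve-∀
    lem₂ : ∀ z n i → z - n + 1ℤ + i ≡ z - (1ℤ + n) + 1ℤ + (1ℤ + i)
    lem₂ = ℤ.solve-∀

  -- Multiplication by `z − n + 1 + e`, since this factor takes `(z)_{n−1−i}` to
  -- `(z)_{n−i} + (e − i)(z)_{n−1−i}`. The weights `e − i` are free of `n`.
  step : ℤ → (ℕ → ℤ) → ℕ → ℤ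
  step e b zero = b 0
  step e b (suc i) = b (suc i) + (e - + i) * b i

  -- The extra `b n` arises because `step` reads one coefficient past the range of the old sum; it
  -- is 0 for coefficients supported below `n`.
  combination-step : ∀ e b n z →
    combination (step e b) (suc n) z ≡ (z - + n + 1ℤ + e) * combination b n z + b n
  combination-step e b n z = begin
    b 0 * descFact z n + Σ< n (λ i → (b (suc i) + (e - + i) * b i) * f i)
      ≡⟨ cong (_+_ (b 0 * descFact z n)) (trans
           (Σ<-cong n (λ i → *-distribʳ-+ (f i) (b (suc i)) ((e - + i) * b i)))
           (Σ<-+ n _ _)) ⟩
    b 0 * descFact z n + (combination (b ∘ suc) n z + rest)
      ≡⟨ +-assoc (b 0 * descFact z n) _ rest ⟨
    combination b (suc n) z + rest
      ≡⟨ cong (_+ rest) (combination-suc b n z) ⟩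
    combination (λ i → (x + + i) * b i) n z + b n + rest
      ≡⟨ lem₁ (combination (λ i → (x + + i) * b i) n z) (b n) rest ⟩
    combination (λ i → (x + + i) * b i) n z + rest + b n
      ≡⟨ cong (_+ b n) (Σ<-+ n _ _) ⟨
    Σ< n (λ i → (x + + i) * b i * f i + (e - + i) * b i * f i) + b n
      ≡⟨ cong (_+ b n) (trans (Σ<-cong n (λ i → lem₂ x e (+ i) (b i) (f i))) (Σ<-* n (x + e) _)) ⟩
    (x + e) * combination b n z + b n ∎
    where
    x = z - + n + 1ℤ
    f : ℕ → ℤ
    f i = descFact z (n ℕ.∸ suc i)
    rest = Σ< n (λ i → (e - + i) * b i * f i)
    lem₁ : ∀ a b c → a + b + c ≡ a + c + b
    lem₁ = ℤ.solve-∀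
    lem₂ : ∀ x e i b f → (x + i) * b * f + (e - i) * b * f ≡ (x + e) * (b * f)
    lem₂ = ℤ.solve-∀

  chuVandermonde : ℕ → ℤ → ℕ → ℤ
  chuVandermonde n y i = + (n C i) * descFact y i

  chuVandermonde-step : ∀ n y i → step y (chuVandermonde n y) i ≡ chuVandermonde (suc n) y i
  chuVandermonde-step n y zero = refl
  chuVandermonde-step n y (suc i) = begin
    + (n C suc i) * (descFact y i * (y - + i)) + (y - + i) * (+ (n C i) * descFact y i)
      ≡⟨ lem (+ (n C suc i)) (descFact y i) (y - + i) (+ (n C i)) ⟩
    + (n C i ℕ.+ n C suc i) * (descFact y i * (y - + i))
      ≡⟨ cong (λ a → + a * (descFact y i * (y - + i))) (nCk+nC[k+1]≡[n+1]C[k+1] n i) ⟩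
    chuVandermonde (suc n) y (suc i) ∎
    where
    lem : ∀ a f y b → a * (f * y) + y * (b * f) ≡ (b + a) * (f * y)
    lem = ℤ.solve-∀

  chuVandermonde-support : ∀ n y {i} → n ℕ.< i → chuVandermonde n y i ≡ 0ℤ
  chuVandermonde-support n y {i} n<i = cong (λ a → + a * descFact y i) (k>n⇒nCk≡0 n<i)

  combination-cong : ∀ n z {b b′ : ℕ → ℤ} → (∀ i → b i ≡ b′ i) → combination b n z ≡ combination b′ n z
  combination-cong n z e = Σ<-cong n (λ i → cong (_* descFact z (n ℕ.∸ suc i)) (e i))

  -- Chu-Vandermonde by induction on `n`: the new factor `z + y − n` acts on the coefficients as
  -- `step y`, which is Pascal's rule.
  descFact-+ : ∀ n y z → descFact (z + y) n ≡ combination (chuVandermonde n y) (suc n) z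
  descFact-+ zero y z = refl
  descFact-+ (suc n) y z = begin
    descFact (z + y) n * (z + y - + n)
      ≡⟨ cong (_* (z + y - + n)) (descFact-+ n y z) ⟩
    combination (chuVandermonde n y) (suc n) z * (z + y - + n)
      ≡⟨ lem _ z y (+ n) ⟩
    (z - + suc n + 1ℤ + y) * combination (chuVandermonde n y) (suc n) z + 0ℤ
      ≡⟨ cong (_+_ ((z - + suc n + 1ℤ + y) * combination (chuVandermonde n y) (suc n) z))
           (chuVandermonde-support n y (ℕ.n<1+n n)) ⟨
    (z - + suc n + 1ℤ + y) * combination (chuVandermonde n y) (suc n) z + chuVandermonde n y (suc n)
      ≡⟨ combination-step y (chuVandermonde n y) (suc n) z ⟨
    combination (step y (chuVandermonde n y)) (suc (suc n)) z
      ≡⟨ combination-cong (suc (suc n)) z (chuVandermonde-step n y) ⟩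
    combination (chuVandermonde (suc n) y) (suc (suc n)) z ∎
    where
    lem : ∀ s z y n → s * (z + y - n) ≡ (z - (1ℤ + n) + 1ℤ + y) * s + 0ℤ
    lem = ℤ.solve-∀

  descFact-vanishes : ∀ {j n} → j ℕ.< n → descFact (+ j) n ≡ 0ℤ
  descFact-vanishes {j} {suc n} (ℕ.s≤s j≤n) with ℕ.m≤n⇒m<n∨m≡n j≤n
  ... | inj₁ j<n = cong (_* (+ j - + n)) (descFact-vanishes j<n)
  ... | inj₂ refl = trans (cong (descFact (+ j) j *_) (+-inverseʳ (+ j))) (*-zeroʳ (descFact (+ j) j))

  -- The coefficients of ∏_{t ≤ j < t+n} (z − k − j) · ∏_{j < u} (z − k − j + ε_j), where k = t + n,
  -- in the basis (z)_{n+u−i}.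
  nodal : (t : ℕ) (ε : ℕ → ℕ) (n u : ℕ) → ℕ → ℤ
  nodal t ε n zero = chuVandermonde n (- + (t ℕ.+ n ℕ.+ t))
  nodal t ε n (suc u) = step (+ ε u - + t) (nodal t ε n u)

  module _ (t : ℕ) (ε : ℕ → ℕ) (n : ℕ) where

    nodal-support : ∀ u {i} → n ℕ.+ u ℕ.< i → nodal t ε n u i ≡ 0ℤ
    nodal-support zero {i} p = chuVandermonde-support n _ (subst (ℕ._< i) (ℕ.+-identityʳ n) p)
    nodal-support (suc u) {suc i} p = trans
      (cong₂ (λ a b → a + (+ ε u - + t - + i) * b)
        (nodal-support u (ℕ.≤-trans q (ℕ.n≤1+n i))) (nodal-support u q))
      (trans (+-identityˡ _) (*-zeroʳ (+ ε u - + t - + i)))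
      where
      q : suc (n ℕ.+ u) ℕ.≤ i
      q = subst (ℕ._≤ i) (ℕ.+-suc n u) (ℕ.s≤s⁻¹ p)

    -- The polynomial is monic, so its vanishing at a node can be solved for the highest factorial.
    nodal-head : ∀ u → nodal t ε n u 0 ≡ 1ℤ
    nodal-head zero = refl
    nodal-head (suc u) = nodal-head u

    -- The parameter `ε u − t` is chosen so that `step`, applied to `n + u + 1` coefficients,
    -- multiplies by `z − (k + u − ε u)` with `k = t + n`.
    combination-nodal : ∀ u z → combination (nodal t ε n (suc u)) (suc (n ℕ.+ suc u)) z ≡
      (z - (+ (t ℕ.+ n ℕ.+ u) - + ε u)) * combination (nodal t ε n u) (suc (n ℕ.+ u)) z
    combination-nodal u z = begin
      combination b′ (suc (n ℕ.+ suc u)) z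
        ≡⟨ cong (λ m → combination b′ (suc m) z) (ℕ.+-suc n u) ⟩
      combination b′ (suc (suc (n ℕ.+ u))) z
        ≡⟨ combination-step (+ ε u - + t) b (suc (n ℕ.+ u)) z ⟩
      (z - + suc (n ℕ.+ u) + 1ℤ + (+ ε u - + t)) * S + b (suc (n ℕ.+ u))
        ≡⟨ cong (_+_ ((z - + suc (n ℕ.+ u) + 1ℤ + (+ ε u - + t)) * S)) (nodal-support u (ℕ.n<1+n (n ℕ.+ u))) ⟩
      (z - + suc (n ℕ.+ u) + 1ℤ + (+ ε u - + t)) * S + 0ℤ
        ≡⟨ lem z (+ n) (+ u) (+ ε u) (+ t) S ⟩
      (z - (+ (t ℕ.+ n ℕ.+ u) - + ε u)) * S ∎
      where
      b = nodal t ε n u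
      b′ = nodal t ε n (suc u)
      S = combination b (suc (n ℕ.+ u)) z
      lem : ∀ z n u e t s → (z - (1ℤ + (n + u)) + 1ℤ + (e - t)) * s + 0ℤ ≡ (z - (t + n + u - e)) * s
      lem = ℤ.solve-∀

    nodal-vanishes-shifted : ∀ u {j} → j ℕ.< u →
      combination (nodal t ε n u) (suc (n ℕ.+ u)) (+ (t ℕ.+ n ℕ.+ j) - + ε j) ≡ 0ℤ
    nodal-vanishes-shifted (suc u) {j} (ℕ.s≤s j≤u) with ℕ.m≤n⇒m<n∨m≡n j≤u
    ... | inj₁ j<u = trans (combination-nodal u c)
            (trans (cong ((c - (+ (t ℕ.+ n ℕ.+ u) - + ε u)) *_) (nodal-vanishes-shifted u j<u))
              (*-zeroʳ (c - (+ (t ℕ.+ n ℕ.+ u) - + ε u))))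
      where c = + (t ℕ.+ n ℕ.+ j) - + ε j
    ... | inj₂ refl = trans (combination-nodal u c)
            (cong (_* combination (nodal t ε n u) (suc (n ℕ.+ u)) c) (+-inverseʳ c))
      where c = + (t ℕ.+ n ℕ.+ j) - + ε j

    -- For `u = 0` the value is `(c − k − t)_n = (j)_n`, which is 0 as `j < n`; further factors
    -- preserve the zero.
    nodal-vanishes-unshifted : ∀ u {j} → j ℕ.< n →
      combination (nodal t ε n u) (suc (n ℕ.+ u)) (+ (t ℕ.+ n ℕ.+ (t ℕ.+ j))) ≡ 0ℤ
    nodal-vanishes-unshifted zero {j} j<n = begin
      combination (nodal t ε n 0) (suc (n ℕ.+ 0)) c
        ≡⟨ cong (λ m → combination (nodal t ε n 0) (suc m) c) (ℕ.+-identityʳ n) ⟩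
      combination (nodal t ε n 0) (suc n) c
        ≡⟨ descFact-+ n (- + (t ℕ.+ n ℕ.+ t)) c ⟨
      descFact (c + - + (t ℕ.+ n ℕ.+ t)) n
        ≡⟨ cong (λ z → descFact z n) (lem (+ t) (+ n) (+ j)) ⟩
      descFact (+ j) n
        ≡⟨ descFact-vanishes j<n ⟩
      0ℤ ∎
      where
      c = + (t ℕ.+ n ℕ.+ (t ℕ.+ j))
      lem : ∀ t n j → t + n + (t + j) + - (t + n + t) ≡ j
      lem = ℤ.solve-∀
    nodal-vanishes-unshifted (suc u) {j} j<n = trans (combination-nodal u c)
      (trans (cong ((c - (+ (t ℕ.+ n ℕ.+ u) - + ε u)) *_) (nodal-vanishes-unshifted u j<n))
        (*-zeroʳ (c - (+ (t ℕ.+ n ℕ.+ u) - + ε u))))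
      where c = + (t ℕ.+ n ℕ.+ (t ℕ.+ j))

  δ : ℕ → ℕ → ℤ
  δ zero zero = 1ℤ
  δ zero (suc i) = 0ℤ
  δ (suc j) zero = 0ℤ
  δ (suc j) (suc i) = δ j i

  -- If (z)_k = Σ_i e_i (z)_{k−1−i}, these are the coefficients of (z)_{m+k−1−j} in the same basis.
  reduced : (ℕ → ℤ) → ℕ → ℕ → ℕ → ℤ
  reduced e j zero i = δ j i
  reduced e j (suc m) i =
    reduced e j m (suc i) + (+ j - + i - + m) * reduced e j m i + reduced e j m 0 * e i

  δ-support : ∀ {j i} → j ℕ.< i → δ j i ≡ 0ℤ
  δ-support {zero} {suc i} p = refl
  δ-support {suc j} {suc i} (ℕ.s≤s p) = δ-support p

  -- The recursion for `reduced` reads index `i + 1`, which is `k` for the last coefficient; that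
  -- value has to be 0.
  reduced-support : ∀ {e j k} → (∀ {i} → k ℕ.≤ i → e i ≡ 0ℤ) → j ℕ.< k →
    ∀ m {i} → k ℕ.≤ i → reduced e j m i ≡ 0ℤ
  reduced-support E j<k zero k≤i = δ-support (ℕ.≤-trans j<k k≤i)
  reduced-support {e} {j} {k} E j<k (suc m) {i} k≤i = trans
    (cong₂ _+_ (cong₂ (λ a b → a + (+ j - + i - + m) * b)
        (reduced-support E j<k m (ℕ.≤-trans k≤i (ℕ.n≤1+n i))) (reduced-support E j<k m k≤i))
      (cong (reduced e j m 0 *_) (E k≤i)))
    (lem (+ j - + i - + m) (reduced e j m 0))
    where
    lem : ∀ a b → 0ℤ + a * 0ℤ + b * 0ℤ ≡ 0ℤ
    lem = ℤ.solve-∀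

  combination-zero : ∀ n z → combination (λ _ → 0ℤ) n z ≡ 0ℤ
  combination-zero n z = Σ<-zero n (λ _ → refl)

  combination-δ : ∀ {j k} z → j ℕ.< k → combination (δ j) k z ≡ descFact z (k ℕ.∸ suc j)
  combination-δ {zero} {suc k} z _ = trans
    (cong (_+_ (1ℤ * descFact z k)) (combination-zero k z))
    (trans (+-identityʳ _) (*-identityˡ _))
  combination-δ {suc j} {suc k} z (ℕ.s≤s j<k) = trans (+-identityˡ _) (combination-δ z j<k)

  -- The next factor is written as `(z − k + 1 + i) + (j − i − m)`. The first part raises
  -- `(z)_{k−1−i}` to `(z)_{k−i}`, the second is a scalar. Only `i = 0` leaves the basis, producing
  -- `(z)_k`, which is replaced by its expansion `e`.
  descFact-reduced : ∀ {e k j z} → (∀ {i} → k ℕ.≤ i → e i ≡ 0ℤ) → descFact z k ≡ combination e k z → j ℕ.< k →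
    ∀ m → descFact z (m ℕ.+ (k ℕ.∸ suc j)) ≡ combination (reduced e j m) k z
  descFact-reduced {z = z} E eq j<k zero = sym (combination-δ z j<k)
  descFact-reduced {e} {k} {j} {z} E eq j<k (suc m) = begin
    descFact z (m ℕ.+ (k ℕ.∸ suc j)) * (z - + (m ℕ.+ (k ℕ.∸ suc j)))
      ≡⟨ cong₂ _*_ (descFact-reduced E eq j<k m) shift ⟩
    combination r k z * (x + + j - + m)
      ≡⟨ *-comm (combination r k z) (x + + j - + m) ⟩
    (x + + j - + m) * combination r k z
      ≡⟨ Σ<-* k (x + + j - + m) _ ⟨
    Σ< k (λ i → (x + + j - + m) * (r i * f i))
      ≡⟨ trans (Σ<-cong k (λ i → lem₁ x (+ j) (+ m) (+ i) (r i) (f i))) (Σ<-+ k _ _) ⟩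
    combination (λ i → (x + + i) * r i) k z + rest
      ≡⟨ cong (_+ rest) (lem₂ (combination (λ i → (x + + i) * r i) k z) (r k) (reduced-support E j<k m ℕ.≤-refl)) ⟩
    combination (λ i → (x + + i) * r i) k z + r k + rest
      ≡⟨ cong (_+ rest) (combination-suc r k z) ⟨
    r 0 * descFact z k + combination (r ∘ suc) k z + rest
      ≡⟨ cong (λ a → r 0 * a + combination (r ∘ suc) k z + rest) eq ⟩
    r 0 * combination e k z + combination (r ∘ suc) k z + rest
      ≡⟨ lem₃ (r 0 * combination e k z) _ _ ⟩
    combination (r ∘ suc) k z + rest + r 0 * combination e k z
      ≡⟨ cong₂ _+_ (Σ<-+ k _ _) (Σ<-* k (r 0) _) ⟨
    Σ< k (λ i → r (suc i) * f i + (+ j - + i - + m) * r i * f i) + Σ< k (λ i → r 0 * (e i * f i))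
      ≡⟨ Σ<-+ k _ _ ⟨
    Σ< k (λ i → r (suc i) * f i + (+ j - + i - + m) * r i * f i + r 0 * (e i * f i))
      ≡⟨ Σ<-cong k (λ i → lem₄ (r (suc i)) ((+ j - + i - + m) * r i) (r 0) (e i) (f i)) ⟩
    combination (reduced e j (suc m)) k z ∎
    where
    r = reduced e j m
    x = z - + k + 1ℤ
    f : ℕ → ℤ
    f i = descFact z (k ℕ.∸ suc i)
    rest = Σ< k (λ i → (+ j - + i - + m) * r i * f i)
    shift : z - + (m ℕ.+ (k ℕ.∸ suc j)) ≡ x + + j - + m
    shift = trans (lem z (+ m) (+ (k ℕ.∸ suc j)) (+ j))
      (cong (λ q → z - + q + 1ℤ + + j - + m) (ℕ.m∸n+n≡m j<k))
      where
      lem : ∀ z m r j → z - (m + r) ≡ z - (r + (1ℤ + j)) + 1ℤ + j - m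
      lem = ℤ.solve-∀
    lem₁ : ∀ x j m i r f → (x + j - m) * (r * f) ≡ (x + i) * r * f + (j - i - m) * r * f
    lem₁ = ℤ.solve-∀
    lem₂ : ∀ a b → b ≡ 0ℤ → a ≡ a + b
    lem₂ a .0ℤ refl = sym (+-identityʳ a)
    lem₃ : ∀ a b c → a + b + c ≡ b + c + a
    lem₃ = ℤ.solve-∀
    lem₄ : ∀ a b c e f → a * f + b * f + c * (e * f) ≡ (a + b + c * e) * f
    lem₄ = ℤ.solve-∀

module _ where
  -- Polynomial dependence on k
  open ≡-Reasoning

  -- Unnormalised rationals have explicit sums and products, so identities about `toℚ` reduce to
  -- integer identities without gcds.
  fromℚᵘ-homo-+ : ∀ p q → fromℚᵘ (p ℚᵘ.+ q) ≡ fromℚᵘ p ℚ.+ fromℚᵘ q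
  fromℚᵘ-homo-+ p q = ℚ.toℚᵘ-injective (ℚᵘ.≃-trans (ℚ.toℚᵘ-fromℚᵘ (p ℚᵘ.+ q))
    (ℚᵘ.≃-sym (ℚᵘ.≃-trans (ℚ.toℚᵘ-homo-+ (fromℚᵘ p) (fromℚᵘ q))
      (ℚᵘ.+-cong (ℚ.toℚᵘ-fromℚᵘ p) (ℚ.toℚᵘ-fromℚᵘ q)))))

  fromℚᵘ-homo-* : ∀ p q → fromℚᵘ (p ℚᵘ.* q) ≡ fromℚᵘ p ℚ.* fromℚᵘ q
  fromℚᵘ-homo-* p q = ℚ.toℚᵘ-injective (ℚᵘ.≃-trans (ℚ.toℚᵘ-fromℚᵘ (p ℚᵘ.* q))
    (ℚᵘ.≃-sym (ℚᵘ.≃-trans (ℚ.toℚᵘ-homo-* (fromℚᵘ p) (fromℚᵘ q))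
      (ℚᵘ.*-cong (ℚ.toℚᵘ-fromℚᵘ p) (ℚ.toℚᵘ-fromℚᵘ q)))))

  toℚ-+ : ∀ a b → toℚ (a ℤ.+ b) ≡ toℚ a ℚ.+ toℚ b
  toℚ-+ a b = trans
    (ℚ.fromℚᵘ-cong {mkℚᵘ (a ℤ.+ b) 0} {mkℚᵘ a 0 ℚᵘ.+ mkℚᵘ b 0} (*≡* (lem a b)))
    (fromℚᵘ-homo-+ (mkℚᵘ a 0) (mkℚᵘ b 0))
    where
    lem : ∀ a b → (a ℤ.+ b) ℤ.* + 1 ≡ (a ℤ.* + 1 ℤ.+ b ℤ.* + 1) ℤ.* + 1
    lem = ℤ.solve-∀

  toℚ-* : ∀ a b → toℚ (a ℤ.* b) ≡ toℚ a ℚ.* toℚ b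
  toℚ-* a b = trans
    (ℚ.fromℚᵘ-cong {mkℚᵘ (a ℤ.* b) 0} {mkℚᵘ a 0 ℚᵘ.* mkℚᵘ b 0} (*≡* refl))
    (fromℚᵘ-homo-* (mkℚᵘ a 0) (mkℚᵘ b 0))

  reciprocal : ∀ i → fromℚᵘ (mkℚᵘ (+ 1) i) ℚ.* toℚ (+ suc i) ≡ ℚ.1ℚ
  reciprocal i = trans (sym (fromℚᵘ-homo-* (mkℚᵘ (+ 1) i) (mkℚᵘ (+ suc i) 0)))
    (ℚ.fromℚᵘ-cong {mkℚᵘ (+ 1) i ℚᵘ.* mkℚᵘ (+ suc i) 0} {mkℚᵘ (+ 1) 0} (*≡* (cong +_ (lem i))))
    where
    lem : ∀ i → (suc i ℕ.+ 0) ℕ.* 1 ≡ suc i ℕ.* 1 ℕ.+ 0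
    lem = ℕ.solve-∀

  -- Arithmetic of coefficient lists

  infixl 6 _⊞_
  infixl 7 _⊠_

  _⊞_ : List ℚ → List ℚ → List ℚ
  [] ⊞ q = q
  (a ∷ p) ⊞ [] = a ∷ p
  (a ∷ p) ⊞ (b ∷ q) = a ℚ.+ b ∷ p ⊞ q

  scale : ℚ → List ℚ → List ℚ
  scale c = map (c ℚ.*_)

  _⊠_ : List ℚ → List ℚ → List ℚ
  [] ⊠ q = []
  (a ∷ p) ⊠ q = scale a q ⊞ (ℚ.0ℚ ∷ p ⊠ q)

  open +-*-Solver using (solve; _:+_; _:*_; _:=_; con)

  evalPoly-⊞ : ∀ p q x → evalPoly (p ⊞ q) x ≡ evalPoly p x ℚ.+ evalPoly q x
  evalPoly-⊞ [] q x = sym (ℚ.+-identityˡ _)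
  evalPoly-⊞ (a ∷ p) [] x = sym (ℚ.+-identityʳ _)
  evalPoly-⊞ (a ∷ p) (b ∷ q) x = trans
    (cong (λ r → a ℚ.+ b ℚ.+ x ℚ.* r) (evalPoly-⊞ p q x))
    (solve 5 (λ a b x p q → a :+ b :+ x :* (p :+ q) := (a :+ x :* p) :+ (b :+ x :* q)) refl
      a b x (evalPoly p x) (evalPoly q x))

  evalPoly-scale : ∀ c p x → evalPoly (scale c p) x ≡ c ℚ.* evalPoly p x
  evalPoly-scale c [] x = sym (ℚ.*-zeroʳ c)
  evalPoly-scale c (a ∷ p) x = trans
    (cong (λ r → c ℚ.* a ℚ.+ x ℚ.* r) (evalPoly-scale c p x))
    (solve 4 (λ c a x p → c :* a :+ x :* (c :* p) := c :* (a :+ x :* p)) refl c a x (evalPoly p x))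

  evalPoly-⊠ : ∀ p q x → evalPoly (p ⊠ q) x ≡ evalPoly p x ℚ.* evalPoly q x
  evalPoly-⊠ [] q x = sym (ℚ.*-zeroˡ (evalPoly q x))
  evalPoly-⊠ (a ∷ p) q x = begin
    evalPoly (scale a q ⊞ (ℚ.0ℚ ∷ p ⊠ q)) x
      ≡⟨ evalPoly-⊞ (scale a q) (ℚ.0ℚ ∷ p ⊠ q) x ⟩
    evalPoly (scale a q) x ℚ.+ (ℚ.0ℚ ℚ.+ x ℚ.* evalPoly (p ⊠ q) x)
      ≡⟨ cong₂ (λ u v → u ℚ.+ (ℚ.0ℚ ℚ.+ x ℚ.* v)) (evalPoly-scale a q x) (evalPoly-⊠ p q x) ⟩
    a ℚ.* evalPoly q x ℚ.+ (ℚ.0ℚ ℚ.+ x ℚ.* (evalPoly p x ℚ.* evalPoly q x))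
      ≡⟨ cong (a ℚ.* evalPoly q x ℚ.+_) (ℚ.+-identityˡ _) ⟩
    a ℚ.* evalPoly q x ℚ.+ x ℚ.* (evalPoly p x ℚ.* evalPoly q x)
      ≡⟨ solve 4 (λ a x p q → a :* q :+ x :* (p :* q) := (a :+ x :* p) :* q) refl
           a x (evalPoly p x) (evalPoly q x) ⟩
    (a ℚ.+ x ℚ.* evalPoly p x) ℚ.* evalPoly q x ∎

  length-⊞ : ∀ p q → length (p ⊞ q) ≡ length p ℕ.⊔ length q
  length-⊞ [] q = refl
  length-⊞ (a ∷ p) [] = refl
  length-⊞ (a ∷ p) (b ∷ q) = cong suc (length-⊞ p q)

  -- Degrees add, and a list of length `d + 1` stands for degree at most `d`. The second factor is
  -- nonempty because multiplying by `[]` pads with zeros.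
  length-⊠ : ∀ p b q → length (p ⊠ (b ∷ q)) ℕ.≤ length p ℕ.+ length q
  length-⊠ [] b q = z≤n
  length-⊠ (a ∷ p) b q = s≤s (subst (ℕ._≤ length p ℕ.+ length q) (sym (length-⊞ (scale a q) (p ⊠ (b ∷ q))))
    (ℕ.⊔-lub (subst (ℕ._≤ length p ℕ.+ length q) (sym (length-map (a ℚ.*_) q)) (ℕ.m≤n+m (length q) (length p)))
      (length-⊠ p b q)))

  suc≤suc∸⇒+≤ : ∀ x a b → suc x ℕ.≤ suc a ℕ.∸ b → b ℕ.+ x ℕ.≤ a
  suc≤suc∸⇒+≤ x a zero p = ℕ.s≤s⁻¹ p
  suc≤suc∸⇒+≤ x (suc a) (suc b) p = s≤s (suc≤suc∸⇒+≤ x a b p)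
  suc≤suc∸⇒+≤ x zero (suc b) p with () ← subst (suc x ℕ.≤_) (ℕ.0∸n≡0 b) p

  ∸-mono-cross : ∀ {a b a′ b′} → a ℕ.+ b′ ℕ.≤ a′ ℕ.+ b → suc a ℕ.∸ b ℕ.≤ suc a′ ℕ.∸ b′
  ∸-mono-cross {a} {b} {a′} {b′} p = subst₂ ℕ._≤_ (cancel (suc a) b′ b)
    (trans (cong (suc (a′ ℕ.+ b) ℕ.∸_) (ℕ.+-comm b b′)) (cancel (suc a′) b b′))
    (ℕ.∸-monoˡ-≤ (b ℕ.+ b′) (s≤s p))
    where
    cancel : ∀ x y z → x ℕ.+ y ℕ.∸ (z ℕ.+ y) ≡ x ℕ.∸ z
    cancel x y z = trans (cong₂ ℕ._∸_ (ℕ.+-comm x y) (ℕ.+-comm z y)) (ℕ.[m+n]∸[m+o]≡n∸o y x z)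

  -- f is, as a function of k = t + n, a polynomial of degree ≤ a − b; it vanishes if a < b.
  record Poly (t a b : ℕ) (f : ℕ → ℤ) : Set where
    constructor poly
    field
      coefficients : List ℚ
      length≤ : length coefficients ℕ.≤ suc a ℕ.∸ b
      evaluates : ∀ n → toℚ (f n) ≡ evalPoly coefficients (toℚ (+ (t ℕ.+ n)))

  module _ {t : ℕ} where

    Poly-weaken : ∀ {a b a′ b′ f} → a ℕ.+ b′ ℕ.≤ a′ ℕ.+ b → Poly t a b f → Poly t a′ b′ f
    Poly-weaken {a} p (poly Q l e) = poly Q (ℕ.≤-trans l (∸-mono-cross {a} p)) e

    Poly-cong : ∀ {a b f g} → (∀ n → f n ≡ g n) → Poly t a b f → Poly t a b g
    Poly-cong p (poly Q l e) = poly Q l (λ n → trans (cong toℚ (sym (p n))) (e n))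

    Poly-zero : ∀ {a b} → Poly t a b (λ _ → ℤ.0ℤ)
    Poly-zero = poly [] z≤n (λ _ → refl)

    Poly-const : ∀ {a b} → b ℕ.≤ a → ∀ z → Poly t a b (λ _ → z)
    Poly-const {a} {b} p z = poly (toℚ z ∷ []) (ℕ.m<n⇒0<n∸m (s≤s p))
      (λ n → sym (trans (cong (toℚ z ℚ.+_) (ℚ.*-zeroʳ (toℚ (+ (t ℕ.+ n))))) (ℚ.+-identityʳ (toℚ z))))

    Poly-k : Poly t 1 0 (λ n → + (t ℕ.+ n))
    Poly-k = poly (ℚ.0ℚ ∷ ℚ.1ℚ ∷ []) ℕ.≤-refl (λ n → lem (toℚ (+ (t ℕ.+ n))))
      where
      lem : ∀ x → x ≡ ℚ.0ℚ ℚ.+ x ℚ.* (ℚ.1ℚ ℚ.+ x ℚ.* ℚ.0ℚ)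
      lem = solve 1 (λ x → x := con ℚ.0ℚ :+ x :* (con ℚ.1ℚ :+ x :* con ℚ.0ℚ)) refl

    Poly-+ : ∀ {a b f g} → Poly t a b f → Poly t a b g → Poly t a b (λ n → f n ℤ.+ g n)
    Poly-+ {a} {b} {f} {g} (poly P l e) (poly Q m e′) = poly (P ⊞ Q)
      (subst (ℕ._≤ suc a ℕ.∸ b) (sym (length-⊞ P Q)) (ℕ.⊔-lub l m))
      (λ n → trans (toℚ-+ (f n) (g n)) (trans (cong₂ ℚ._+_ (e n) (e′ n)) (sym (evalPoly-⊞ P Q (toℚ (+ (t ℕ.+ n)))))))

    -- Truncated differences do not add, so zero polynomials are treated first. A nonempty list
    -- certifies `b ≤ a`, respectively `d ≤ c`, and then the degree bounds add.
    Poly-* : ∀ {a b c d f g} → Poly t a b f → Poly t c d g → Poly t (a ℕ.+ c) (b ℕ.+ d) (λ n → f n ℤ.* g n)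
    Poly-* {f = f} {g} (poly [] l e) _ = poly [] z≤n (λ n →
      trans (toℚ-* (f n) (g n)) (trans (cong (ℚ._* toℚ (g n)) (e n)) (ℚ.*-zeroˡ (toℚ (g n)))))
    Poly-* {f = f} {g} (poly (_ ∷ _) l e) (poly [] m e′) = poly [] z≤n (λ n →
      trans (toℚ-* (f n) (g n)) (trans (cong (toℚ (f n) ℚ.*_) (e′ n)) (ℚ.*-zeroʳ (toℚ (f n)))))
    Poly-* {a} {b} {c} {d} {f} {g} (poly P@(_ ∷ P′) l e) (poly Q@(q ∷ Q′) m e′) = poly (P ⊠ Q)
      (ℕ.≤-trans (length-⊠ P q Q′) (ℕ.m+n≤o⇒m≤o∸n _ (s≤s bound)))
      (λ n → trans (toℚ-* (f n) (g n)) (trans (cong₂ ℚ._*_ (e n) (e′ n)) (sym (evalPoly-⊠ P Q (toℚ (+ (t ℕ.+ n)))))))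
      where
      lem : ∀ b d x y → b ℕ.+ x ℕ.+ (d ℕ.+ y) ≡ x ℕ.+ y ℕ.+ (b ℕ.+ d)
      lem = ℕ.solve-∀
      bound : length P′ ℕ.+ length Q′ ℕ.+ (b ℕ.+ d) ℕ.≤ a ℕ.+ c
      bound = subst (ℕ._≤ a ℕ.+ c) (lem b d (length P′) (length Q′))
        (ℕ.+-mono-≤ (suc≤suc∸⇒+≤ (length P′) a b l) (suc≤suc∸⇒+≤ (length Q′) c d m))

    Poly-scale : ∀ {a b f} z → Poly t a b f → Poly t a b (λ n → z ℤ.* f n)
    Poly-scale {f = f} z p = Poly-* {g = f} (Poly-const {0} z≤n z) p

    Poly-neg : ∀ {a b f} → Poly t a b f → Poly t a b (λ n → ℤ.- f n)
    Poly-neg {f = f} p = Poly-cong (λ n → ℤ.-1*i≡-i (f n)) (Poly-scale ℤ.-1ℤ p)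

    -- Serves the binomial coefficients, whose denominators force the coefficients to be rational.
    Poly-divide : ∀ {a b f g} i → (∀ n → + suc i ℤ.* f n ≡ g n) → Poly t a b g → Poly t a b f
    Poly-divide {a} {b} {f} {g} i p (poly Q l e) = poly (scale r Q)
      (subst (ℕ._≤ suc a ℕ.∸ b) (sym (length-map (r ℚ.*_) Q)) l)
      (λ n → begin
        toℚ (f n)                          ≡⟨ ℚ.*-identityˡ _ ⟨
        ℚ.1ℚ ℚ.* toℚ (f n)                 ≡⟨ cong (ℚ._* toℚ (f n)) (reciprocal i) ⟨
        r ℚ.* toℚ (+ suc i) ℚ.* toℚ (f n)  ≡⟨ ℚ.*-assoc r (toℚ (+ suc i)) (toℚ (f n)) ⟩
        r ℚ.* (toℚ (+ suc i) ℚ.* toℚ (f n)) ≡⟨ cong (r ℚ.*_) (trans (sym (toℚ-* (+ suc i) (f n))) (trans (cong toℚ (p n)) (e n))) ⟩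
        r ℚ.* evalPoly Q (toℚ (+ (t ℕ.+ n))) ≡⟨ evalPoly-scale r Q _ ⟨
        evalPoly (scale r Q) (toℚ (+ (t ℕ.+ n))) ∎)
      where
      r = fromℚᵘ (mkℚᵘ (+ 1) i)

    -- Degrees of the coefficients and of determinants

    Poly-affine : ∀ z w → Poly t 1 0 (λ n → z ℤ.* + (t ℕ.+ n) ℤ.+ w)
    Poly-affine z w = Poly-+ {f = λ n → z ℤ.* + (t ℕ.+ n)} (Poly-scale z Poly-k) (Poly-const z≤n w)

    Poly-descFact : ∀ {f} i → Poly t 1 0 f → Poly t i 0 (λ n → descFact (f n) i)
    Poly-descFact zero p = Poly-const z≤n ℤ.1ℤ
    Poly-descFact {f} (suc i) p = subst (λ a → Poly t a 0 (λ n → descFact (f n) (suc i))) (ℕ.+-comm i 1)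
      (Poly-* {f = λ n → descFact (f n) i} (Poly-descFact i p) (Poly-+ {f = f} p (Poly-const z≤n (ℤ.- + i))))

    -- With `n − i` taken in the integers this also holds for `n < i`, where both sides are 0, so it
    -- is a polynomial recursion valid for all `n`.
    C-absorption : ∀ n i → + suc i ℤ.* + (n C suc i) ≡ (+ n ℤ.- + i) ℤ.* + (n C i)
    C-absorption zero zero = refl
    C-absorption zero (suc i) = trans (ℤ.*-zeroʳ (+ suc (suc i))) (sym (ℤ.*-zeroʳ (+ 0 ℤ.- + suc i)))
    C-absorption (suc n) zero = begin
      + 1 ℤ.* + (suc n C 1)
        ≡⟨ cong (λ a → + 1 ℤ.* + a) (nCk+nC[k+1]≡[n+1]C[k+1] n 0) ⟨
      + 1 ℤ.* (+ 1 ℤ.+ + (n C 1))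
        ≡⟨ lem₁ (+ (n C 1)) ⟩
      + 1 ℤ.+ + 1 ℤ.* + (n C 1)
        ≡⟨ cong (ℤ._+_ (+ 1)) (C-absorption n zero) ⟩
      + 1 ℤ.+ (+ n ℤ.- + 0) ℤ.* + 1
        ≡⟨ lem₂ (+ n) ⟩
      (+ suc n ℤ.- + 0) ℤ.* + 1 ∎
      where
      lem₁ : ∀ a → + 1 ℤ.* (+ 1 ℤ.+ a) ≡ + 1 ℤ.+ + 1 ℤ.* a
      lem₁ = ℤ.solve-∀
      lem₂ : ∀ n → + 1 ℤ.+ (n ℤ.- + 0) ℤ.* + 1 ≡ (+ 1 ℤ.+ n ℤ.- + 0) ℤ.* + 1
      lem₂ = ℤ.solve-∀
    C-absorption (suc n) (suc i) = begin
      + suc (suc i) ℤ.* + (suc n C suc (suc i))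
        ≡⟨ cong (λ a → + suc (suc i) ℤ.* + a) (nCk+nC[k+1]≡[n+1]C[k+1] n (suc i)) ⟨
      + suc (suc i) ℤ.* (+ c₁ ℤ.+ + (n C suc (suc i)))
        ≡⟨ ℤ.*-distribˡ-+ (+ suc (suc i)) (+ c₁) (+ (n C suc (suc i))) ⟩
      + suc (suc i) ℤ.* + c₁ ℤ.+ + suc (suc i) ℤ.* + (n C suc (suc i))
        ≡⟨ cong (ℤ._+_ (+ suc (suc i) ℤ.* + c₁)) (C-absorption n (suc i)) ⟩
      + suc (suc i) ℤ.* + c₁ ℤ.+ (+ n ℤ.- + suc i) ℤ.* + c₁
        ≡⟨ lem₁ (+ i) (+ c₁) (+ n) ⟩
      (+ n ℤ.- + i) ℤ.* + c₁ ℤ.+ + suc i ℤ.* + c₁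
        ≡⟨ cong (ℤ._+_ ((+ n ℤ.- + i) ℤ.* + c₁)) (C-absorption n i) ⟩
      (+ n ℤ.- + i) ℤ.* + c₁ ℤ.+ (+ n ℤ.- + i) ℤ.* + (n C i)
        ≡⟨ lem₂ (+ n) (+ i) (+ c₁) (+ (n C i)) ⟩
      (+ suc n ℤ.- + suc i) ℤ.* (+ (n C i) ℤ.+ + c₁)
        ≡⟨ cong (λ a → (+ suc n ℤ.- + suc i) ℤ.* + a) (nCk+nC[k+1]≡[n+1]C[k+1] n i) ⟩
      (+ suc n ℤ.- + suc i) ℤ.* + (suc n C suc i) ∎
      where
      c₁ = n C suc i
      lem₁ : ∀ i c n → (+ 2 ℤ.+ i) ℤ.* c ℤ.+ (n ℤ.- (+ 1 ℤ.+ i)) ℤ.* c ≡ (n ℤ.- i) ℤ.* c ℤ.+ (+ 1 ℤ.+ i) ℤ.* c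
      lem₁ = ℤ.solve-∀
      lem₂ : ∀ n i c d → (n ℤ.- i) ℤ.* c ℤ.+ (n ℤ.- i) ℤ.* d ≡ (+ 1 ℤ.+ n ℤ.- (+ 1 ℤ.+ i)) ℤ.* (d ℤ.+ c)
      lem₂ = ℤ.solve-∀

    Poly-C : ∀ i → Poly t i 0 (λ n → + (n C i))
    Poly-C zero = Poly-const z≤n ℤ.1ℤ
    Poly-C (suc i) = Poly-divide i (λ n → trans (C-absorption n i) (cong (ℤ._* + (n C i)) (lem (+ n) (+ i) (+ t))))
      (Poly-* {f = λ n → + 1 ℤ.* + (t ℕ.+ n) ℤ.+ (ℤ.- + (t ℕ.+ i))} (Poly-affine (+ 1) (ℤ.- + (t ℕ.+ i))) (Poly-C i))
      where
      lem : ∀ n i t → n ℤ.- i ≡ + 1 ℤ.* (t ℤ.+ n) ℤ.+ (ℤ.- (t ℤ.+ i))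
      lem = ℤ.solve-∀

    -- `C(n,i)` and `(−k−t)_i` have degree at most `i` each. Every `step` adds a multiple of the
    -- preceding coefficient by a constant, which has a smaller bound.
    Poly-nodal : ∀ ε u i → Poly t (i ℕ.+ i) 0 (λ n → nodal t ε n u i)
    Poly-nodal ε zero i = Poly-* {f = λ n → + (n C i)} (Poly-C i)
      (Poly-descFact i (Poly-cong (λ n → lem (+ n) (+ t)) (Poly-affine ℤ.-1ℤ (ℤ.- + t))))
      where
      lem : ∀ n t → ℤ.-1ℤ ℤ.* (t ℤ.+ n) ℤ.+ (ℤ.- t) ≡ ℤ.- (t ℤ.+ n ℤ.+ t)
      lem = ℤ.solve-∀
    Poly-nodal ε (suc u) zero = Poly-nodal ε u zero
    Poly-nodal ε (suc u) (suc i) = Poly-+ {f = λ n → nodal t ε n u (suc i)}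
      (Poly-nodal ε u (suc i))
      (Poly-weaken (ℕ.+-monoˡ-≤ 0 (ℕ.+-mono-≤ (ℕ.n≤1+n i) (ℕ.n≤1+n i)))
        (Poly-scale {f = λ n → nodal t ε n u i} (+ ε u ℤ.- + t ℤ.- + i) (Poly-nodal ε u i)))

    -- The bound `2(i − j)` is 0 on the diagonal. Below it the bound is negative and asks for the
    -- zero polynomial.
    Poly-δ : ∀ j i → Poly t (i ℕ.+ i) (j ℕ.+ j) (λ _ → δ j i)
    Poly-δ zero zero = Poly-const z≤n ℤ.1ℤ
    Poly-δ zero (suc i) = Poly-zero
    Poly-δ (suc j) zero = Poly-zero
    Poly-δ (suc j) (suc i) = Poly-weaken (ℕ.≤-reflexive (lem i j)) (Poly-δ j i)
      where
      lem : ∀ i j → i ℕ.+ i ℕ.+ (suc j ℕ.+ suc j) ≡ suc i ℕ.+ suc i ℕ.+ (j ℕ.+ j)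
      lem = ℕ.solve-∀

    -- The bound is `2(m + i − j)`. For `m + 1` it is met by the shifted term of index `i + 1`, and
    -- by the product, where `2(m − j)` and `2(i + 1)` add up.
    Poly-reduced : ∀ {e : ℕ → ℕ → ℤ} → (∀ i → Poly t (suc i ℕ.+ suc i) 0 (λ n → e n i)) →
      ∀ j m i → Poly t (m ℕ.+ m ℕ.+ (i ℕ.+ i)) (j ℕ.+ j) (λ n → reduced (e n) j m i)
    Poly-reduced p j zero i = Poly-δ j i
    Poly-reduced {e} p j (suc m) i = Poly-+ {f = λ n → reduced (e n) j m (suc i) ℤ.+ z ℤ.* reduced (e n) j m i}
      (Poly-+ {f = λ n → reduced (e n) j m (suc i)}
        (Poly-weaken (ℕ.≤-reflexive (lem₁ m i (j ℕ.+ j))) (Poly-reduced p j m (suc i)))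
        (Poly-weaken (ℕ.+-monoˡ-≤ (j ℕ.+ j) (ℕ.+-monoˡ-≤ (i ℕ.+ i) (ℕ.+-mono-≤ (ℕ.n≤1+n m) (ℕ.n≤1+n m))))
          (Poly-scale {f = λ n → reduced (e n) j m i} z (Poly-reduced p j m i))))
      (Poly-weaken (ℕ.≤-reflexive (lem₂ m i (j ℕ.+ j)))
        (Poly-* {f = λ n → reduced (e n) j m 0} {g = λ n → e n i} (Poly-reduced p j m 0) (p i)))
      where
      z = + j ℤ.- + i ℤ.- + m
      lem₁ : ∀ m i d → m ℕ.+ m ℕ.+ (suc i ℕ.+ suc i) ℕ.+ d ≡ suc m ℕ.+ suc m ℕ.+ (i ℕ.+ i) ℕ.+ d
      lem₁ = ℕ.solve-∀
      lem₂ : ∀ m i d → m ℕ.+ m ℕ.+ 0 ℕ.+ (suc i ℕ.+ suc i) ℕ.+ d ≡ suc m ℕ.+ suc m ℕ.+ (i ℕ.+ i) ℕ.+ (d ℕ.+ 0)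
      lem₂ = ℕ.solve-∀

    -- The entry bounds split into a row part `a − b` and a column weight `w`, so all terms of the
    -- expansion share one bound.
    Poly-laplace : ∀ {L : Set} {φ : ℕ → L → ℤ} {F : ℕ → List L → ℤ} (w : L → ℕ) {a b a′ b′} →
      (∀ l → Poly t (a ℕ.+ w l) b (λ n → φ n l)) →
      (∀ ls → Poly t (a′ ℕ.+ sum (map w ls)) b′ (λ n → F n ls)) →
      ∀ ls → Poly t (a ℕ.+ a′ ℕ.+ sum (map w ls)) (b ℕ.+ b′) (λ n → laplace (φ n) (F n) ls)
    Poly-laplace w p q [] = Poly-zero
    Poly-laplace {φ = φ} {F} w {a} {b} {a′} {b′} p q (l ∷ ls) = Poly-+ {f = λ n → φ n l ℤ.* F n ls}
      (Poly-weaken (ℕ.+-monoˡ-≤ (b ℕ.+ b′) (ℕ.≤-reflexive (lem₁ a (w l) a′ (sum (map w ls)))))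
        (Poly-* {f = λ n → φ n l} {g = λ n → F n ls} (p l) (q ls)))
      (Poly-neg {f = λ n → laplace (φ n) (λ us → F n (l ∷ us)) ls}
        (Poly-weaken (ℕ.+-monoˡ-≤ (b ℕ.+ b′) (ℕ.≤-reflexive (lem₂ a a′ (w l) (sum (map w ls)))))
          -- The column `l` stays in the minor, so its weight moves into the constant part of the
          -- bound for `F`.
          (Poly-laplace {φ = φ} {λ n us → F n (l ∷ us)} w {a} {b} {a′ ℕ.+ w l} {b′} p
            (λ us → Poly-weaken (ℕ.+-monoˡ-≤ b′ (ℕ.≤-reflexive (sym (ℕ.+-assoc a′ (w l) (sum (map w us)))))) (q (l ∷ us)))
            ls)))
      where
      lem₁ : ∀ a w a′ s → a ℕ.+ w ℕ.+ (a′ ℕ.+ s) ≡ a ℕ.+ a′ ℕ.+ (w ℕ.+ s)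
      lem₁ = ℕ.solve-∀
      lem₂ : ∀ a a′ w s → a ℕ.+ (a′ ℕ.+ w) ℕ.+ s ≡ a ℕ.+ a′ ℕ.+ (w ℕ.+ s)
      lem₂ = ℕ.solve-∀

    Poly-detL : ∀ {J L : Set} {φ : J → ℕ → L → ℤ} (a b : J → ℕ) (w : L → ℕ) →
      (∀ j l → Poly t (a j ℕ.+ w l) (b j) (λ n → φ j n l)) →
      ∀ js ls → Poly t (sum (map a js) ℕ.+ sum (map w ls)) (sum (map b js)) (λ n → detL (map (λ j → φ j n) js) ls)
    Poly-detL a b w p [] [] = Poly-const z≤n ℤ.1ℤ
    Poly-detL a b w p [] (_ ∷ _) = Poly-zero
    Poly-detL {φ = φ} a b w p (j ∷ js) = Poly-laplace {φ = φ j} w (p j) (Poly-detL a b w p js)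

module _ where
  open import Data.Integer using (_+_; _*_; -_; _-_; _^_; 0ℤ; 1ℤ; -1ℤ)
  open import Data.Integer.Properties
  open ≡-Reasoning

  -- The Vandermonde product

  signK-suc : ∀ k → signK (suc k) ≡ -1ℤ ^ k * signK k
  signK-suc k = trans (cong (-1ℤ ^_) (halve k)) (^-distribˡ-+-* -1ℤ k _)
    where
    halve : ∀ k → suc k ℕ.* k / 2 ≡ k ℕ.+ k ℕ.* (k ℕ.∸ 1) / 2
    halve zero = refl
    halve (suc m) = begin
      suc (suc m) ℕ.* suc m / 2                 ≡⟨ cong (_/ 2) (lem m) ⟩
      (suc m ℕ.* 2 ℕ.+ suc m ℕ.* m) / 2         ≡⟨ +-distrib-/-∣ˡ (suc m ℕ.* m) (divides (suc m) refl) ⟩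
      suc m ℕ.* 2 / 2 ℕ.+ suc m ℕ.* m / 2       ≡⟨ cong (ℕ._+ suc m ℕ.* m / 2) (m*n/n≡m (suc m) 2) ⟩
      suc m ℕ.+ suc m ℕ.* m / 2                 ∎
      where
      lem : ∀ m → suc (suc m) ℕ.* suc m ≡ suc m ℕ.* 2 ℕ.+ suc m ℕ.* m
      lem = ℕ.solve-∀

  prodℤ : List ℤ → ℤ
  prodℤ = foldr _*_ (+ 1)

  prodℤ-++ : ∀ xs ys → prodℤ (xs ++ ys) ≡ prodℤ xs * prodℤ ys
  prodℤ-++ [] ys = sym (*-identityˡ (prodℤ ys))
  prodℤ-++ (x ∷ xs) ys = trans (cong (x *_) (prodℤ-++ xs ys)) (sym (*-assoc x (prodℤ xs) (prodℤ ys)))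

  prodℤ-concatMap : ∀ {A : Set} (f : A → List ℤ) xs → prodℤ (concatMap f xs) ≡ ΠL xs (prodℤ ∘ f)
  prodℤ-concatMap f [] = refl
  prodℤ-concatMap f (x ∷ xs) = trans (prodℤ-++ (f x) (concatMap f xs)) (cong (prodℤ (f x) *_) (prodℤ-concatMap f xs))

  ΠL-cong : ∀ {A : Set} (xs : List A) {f g : A → ℤ} → (∀ x → f x ≡ g x) → ΠL xs f ≡ ΠL xs g
  ΠL-cong [] e = refl
  ΠL-cong (x ∷ xs) e = cong₂ _*_ (e x) (ΠL-cong xs e)

  ΠL-tabulate : ∀ {A : Set} n (g : Fin n → A) (f : A → ℤ) → ΠL (tabulate g) f ≡ ΠL (allFin n) (f ∘ g)
  ΠL-tabulate zero g f = refl
  ΠL-tabulate (suc n) g f = cong (f (g zero) *_)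
    (trans (ΠL-tabulate n (g ∘ suc) f) (sym (ΠL-tabulate n suc (f ∘ g))))

  -- Recovers, by unification, the local function that the definition of vandermonde keeps hidden.
  vandermonde-unfold : ∀ k (c : Fin k → ℤ) → Σ[ p ∈ (Fin k → Fin k → List ℤ) ] vandermonde k c ≡
    prodℤ (concatMap (λ i → concatMap (λ j → p i j) (allFin k)) (allFin k))
  vandermonde-unfold k c = _ , refl

  factor : ∀ k → (Fin k → ℤ) → Fin k → Fin k → ℤ
  factor k c i j = prodℤ (proj₁ (vandermonde-unfold k c) i j)

  factor-< : ∀ k c i j → toℕ i ℕ.< toℕ j → factor k c i j ≡ c j - c i
  factor-< k c i j i<j with toℕ i ℕ.<? toℕ j
  ... | yes _ = *-identityʳ (c j - c i)
  ... | no i≮j = contradiction i<j i≮j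

  factor-≮ : ∀ k c i j → ¬ toℕ i ℕ.< toℕ j → factor k c i j ≡ 1ℤ
  factor-≮ k c i j i≮j with toℕ i ℕ.<? toℕ j
  ... | yes i<j = contradiction i<j i≮j
  ... | no _ = refl

  factor-suc : ∀ k c i j → factor (suc k) c (suc i) (suc j) ≡ factor k (c ∘ suc) i j
  factor-suc k c i j = lem (toℕ i ℕ.<? toℕ j)
    where
    lem : Dec (toℕ i ℕ.< toℕ j) → factor (suc k) c (suc i) (suc j) ≡ factor k (c ∘ suc) i j
    lem (yes i<j) = trans (factor-< (suc k) c (suc i) (suc j) (s≤s i<j)) (sym (factor-< k (c ∘ suc) i j i<j))
    lem (no i≮j) = trans (factor-≮ (suc k) c (suc i) (suc j) (i≮j ∘ ℕ.s≤s⁻¹)) (sym (factor-≮ k (c ∘ suc) i j i≮j))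

  vandermonde-factors : ∀ k c → vandermonde k c ≡ ΠL (allFin k) (λ i → ΠL (allFin k) (factor k c i))
  vandermonde-factors k c = trans (proj₂ (vandermonde-unfold k c)) (trans
    (prodℤ-concatMap (λ i → concatMap (proj₁ (vandermonde-unfold k c) i) (allFin k)) (allFin k))
    (ΠL-cong (allFin k) (λ i → prodℤ-concatMap (proj₁ (vandermonde-unfold k c) i) (allFin k))))

  -- Row 0 of the double product gives the differences with `c zero`. In the other rows index 0
  -- contributes 1, and the rest is the product for the shifted sequence.
  vandermonde-suc : ∀ k c → vandermonde (suc k) c ≡ ΠL (tabulate (c ∘ suc)) (_- c zero) * vandermonde k (c ∘ suc)
  vandermonde-suc k c = begin
    vandermonde (suc k) c
      ≡⟨ vandermonde-factors (suc k) c ⟩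
    row zero * ΠL (tabulate suc) row
      ≡⟨ cong₂ _*_ first (trans (ΠL-tabulate k suc row) (ΠL-cong (allFin k) others)) ⟩
    ΠL (tabulate (c ∘ suc)) (_- c zero) * ΠL (allFin k) (λ i → ΠL (allFin k) (factor k (c ∘ suc) i))
      ≡⟨ cong (ΠL (tabulate (c ∘ suc)) (_- c zero) *_) (vandermonde-factors k (c ∘ suc)) ⟨
    ΠL (tabulate (c ∘ suc)) (_- c zero) * vandermonde k (c ∘ suc) ∎
    where
    row : Fin (suc k) → ℤ
    row i = ΠL (allFin (suc k)) (factor (suc k) c i)
    row-tail : ∀ i → factor (suc k) c i zero ≡ 1ℤ → row i ≡ ΠL (allFin k) (factor (suc k) c i ∘ suc)
    row-tail i e = trans (cong (_* ΠL (tabulate suc) (factor (suc k) c i)) e)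
      (trans (*-identityˡ (ΠL (tabulate suc) (factor (suc k) c i))) (ΠL-tabulate k suc (factor (suc k) c i)))
    first : row zero ≡ ΠL (tabulate (c ∘ suc)) (_- c zero)
    first = trans (row-tail zero (factor-≮ (suc k) c zero zero (λ ())))
      (trans (ΠL-cong (allFin k) (λ j → factor-< (suc k) c zero (suc j) (s≤s z≤n)))
        (sym (ΠL-tabulate k (c ∘ suc) (_- c zero))))
    others : ∀ i → row (suc i) ≡ ΠL (allFin k) (factor k (c ∘ suc) i)
    others i = trans (row-tail (suc i) (factor-≮ (suc k) c (suc i) zero (λ ())))
      (ΠL-cong (allFin k) (factor-suc k c i))

  alternant≡vandermonde : ∀ k (c : Fin k → ℤ) → alternant (tabulate c) ≡ signK k * vandermonde k c
  alternant≡vandermonde zero c = refl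
  alternant≡vandermonde (suc k) c = begin
    -1ℤ ^ length (tabulate (c ∘ suc)) * (Π * alternant (tabulate (c ∘ suc)))
      ≡⟨ cong₂ (λ n a → -1ℤ ^ n * (Π * a)) (length-tabulate (c ∘ suc)) (alternant≡vandermonde k (c ∘ suc)) ⟩
    -1ℤ ^ k * (Π * (signK k * vandermonde k (c ∘ suc)))
      ≡⟨ lem (-1ℤ ^ k) Π (signK k) (vandermonde k (c ∘ suc)) ⟩
    -1ℤ ^ k * signK k * (Π * vandermonde k (c ∘ suc))
      ≡⟨ cong₂ _*_ (signK-suc k) (vandermonde-suc k c) ⟨
    signK (suc k) * vandermonde (suc k) c ∎
    where
    Π = ΠL (tabulate (c ∘ suc)) (_- c zero)
    lem : ∀ p q s v → p * (q * (s * v)) ≡ p * s * (q * v)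
    lem = ℤ.solve-∀

  -- Reduction to an s × s determinant

  -- A version of `extend` that does not mention `k`, so that one sequence serves all matrix sizes.
  zeroExtend : ∀ n → (Fin n → ℕ) → ℕ → ℕ
  zeroExtend zero a j = 0
  zeroExtend (suc n) a zero = a zero
  zeroExtend (suc n) a (suc j) = zeroExtend n (a ∘ suc) j

  zeroExtend-fromℕ< : ∀ n a {j} (p : j ℕ.< n) → zeroExtend n a j ≡ a (fromℕ< p)
  zeroExtend-fromℕ< (suc n) a {zero} p = refl
  zeroExtend-fromℕ< (suc n) a {suc j} p = zeroExtend-fromℕ< n (a ∘ suc) (ℕ.s<s⁻¹ p)

  zeroExtend-≥ : ∀ n a {j} → n ℕ.≤ j → zeroExtend n a j ≡ 0
  zeroExtend-≥ zero a p = refl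
  zeroExtend-≥ (suc n) a {suc j} (s≤s p) = zeroExtend-≥ n (a ∘ suc) p

  extend≡zeroExtend : ∀ n a k j → extend n a k j ≡ zeroExtend n a (toℕ j)
  extend≡zeroExtend n a k j with toℕ j ℕ.<? n
  ... | yes p = sym (zeroExtend-fromℕ< n a p)
  ... | no ¬p = sym (zeroExtend-≥ n a (ℕ.≮⇒≥ ¬p))

  sum-doubled : ∀ n (a : Fin n → ℕ) →
    sum (applyUpTo (λ j → zeroExtend n a j ℕ.+ zeroExtend n a j) n) ≡ 2 ℕ.* sumℕ n a
  sum-doubled zero a = refl
  sum-doubled (suc n) a = begin
    a zero ℕ.+ a zero ℕ.+ sum (applyUpTo (λ j → zeroExtend n (a ∘ suc) j ℕ.+ zeroExtend n (a ∘ suc) j) n)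
      ≡⟨ cong (ℕ._+_ (a zero ℕ.+ a zero)) (sum-doubled n (a ∘ suc)) ⟩
    a zero ℕ.+ a zero ℕ.+ 2 ℕ.* sumℕ n (a ∘ suc)
      ≡⟨ lem (a zero) (sumℕ n (a ∘ suc)) ⟩
    2 ℕ.* (a zero ℕ.+ sumℕ n (a ∘ suc))
      ≡⟨ cong (λ xs → 2 ℕ.* (a zero ℕ.+ foldr ℕ._+_ 0 xs))
           (trans (map-tabulate id (a ∘ suc)) (sym (map-tabulate suc a))) ⟩
    2 ℕ.* sumℕ (suc n) a ∎
    where
    lem : ∀ x y → x ℕ.+ x ℕ.+ 2 ℕ.* y ≡ 2 ℕ.* (x ℕ.+ y)
    lem = ℕ.solve-∀

  applyUpTo-+ : ∀ {A : Set} (f : ℕ → A) m n → applyUpTo f (m ℕ.+ n) ≡ applyUpTo f m ++ applyUpTo (f ∘ (m ℕ.+_)) n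
  applyUpTo-+ f zero n = refl
  applyUpTo-+ f (suc m) n = cong (f 0 ∷_) (applyUpTo-+ (f ∘ suc) m n)

  applyUpTo-cong : ∀ {A : Set} {f g : ℕ → A} → (∀ i → f i ≡ g i) → ∀ n → applyUpTo f n ≡ applyUpTo g n
  applyUpTo-cong e zero = refl
  applyUpTo-cong e (suc n) = cong₂ _∷_ (e 0) (applyUpTo-cong (e ∘ suc) n)

  tabulate-toℕ : ∀ {A : Set} n {g : Fin n → A} {f : ℕ → A} → (∀ i → g i ≡ f (toℕ i)) → tabulate g ≡ applyUpTo f n
  tabulate-toℕ zero e = refl
  tabulate-toℕ (suc n) e = cong₂ _∷_ (e zero) (tabulate-toℕ n (e ∘ suc))

  fallings≡applyUpTo : ∀ k → fallings k ≡ applyUpTo (λ i → falling (k ℕ.∸ suc i)) k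
  fallings≡applyUpTo zero = refl
  fallings≡applyUpTo (suc k) = cong (falling k ∷_) (fallings≡applyUpTo k)

  Pointwise-applyUpTo : ∀ {A B : Set} {R : A → B → Set} (f : ℕ → A) (g : ℕ → B) n →
    (∀ {i} → i ℕ.< n → R (f i) (g i)) → Pointwise R (applyUpTo f n) (applyUpTo g n)
  Pointwise-applyUpTo f g zero r = []
  Pointwise-applyUpTo f g (suc n) r = r ℕ.z<s ∷ Pointwise-applyUpTo (f ∘ suc) (g ∘ suc) n (r ∘ s≤s)

  repeated-∈≡0 : ∀ {B : Set} {φs : List (B → ℤ)} {F} → Alternating φs F →
    ∀ ys {x zs} → x ∈ zs → F (ys ++ x ∷ zs) ≡ 0ℤ
  repeated-∈≡0 {F = F} A [] {x} x∈zs with as , bs , refl ← ∈-∃++ x∈zs = repeated≡0 A x as bs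
  repeated-∈≡0 A (y ∷ ys) x∈zs = repeated-∈≡0 (cons A y) ys x∈zs

  -- Only the first s columns differ from those of the Vandermonde matrix; the other columns kill all
  -- terms of their expansions beyond the first s.
  detL-columns : ∀ cs s r (μ : ℕ → ℕ) (T : ℕ → ℕ → ℤ) →
    let k = s ℕ.+ r; v = λ i → falling (k ℕ.∸ suc i) in
    (∀ {j} → j ℕ.< s → All (λ c → descFact c (μ j) ≡ combination (T j) k c) cs) →
    (∀ i → μ (s ℕ.+ i) ≡ k ℕ.∸ suc (s ℕ.+ i)) →
    detL (map eval cs) (applyUpTo (falling ∘ μ) k) ≡
      detL (applyUpTo T s) (upTo s) * detL (map eval cs) (applyUpTo v k)
  detL-columns cs s r μ T reduce same = begin
    F (applyUpTo (falling ∘ μ) k)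
      ≡⟨ cong F (applyUpTo-+ (falling ∘ μ) s r) ⟩
    F (applyUpTo (falling ∘ μ) s ++ applyUpTo (falling ∘ μ ∘ (s ℕ.+_)) r)
      ≡⟨ cong (λ us → F (applyUpTo (falling ∘ μ) s ++ us)) (applyUpTo-cong (cong falling ∘ same) r) ⟩
    F (applyUpTo (falling ∘ μ) s ++ rest)
      ≡⟨ expand (append A rest) v (upTo s)
           (Pointwise-applyUpTo T (falling ∘ μ) s expands)
           (trans (length-applyUpTo (falling ∘ μ) s) (sym (length-applyUpTo id s))) ⟩
    detL (applyUpTo T s) (upTo s) * F (map v (upTo s) ++ rest)
      ≡⟨ cong (λ us → detL (applyUpTo T s) (upTo s) * F us)
           (trans (cong (_++ rest) (map-upTo v s)) (sym (applyUpTo-+ v s r))) ⟩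
    detL (applyUpTo T s) (upTo s) * F (applyUpTo v k) ∎
    where
    k = s ℕ.+ r
    F = detL (map eval cs)
    A = detL-alternating (map eval cs)
    v : ℕ → ℤ → ℤ
    v i = falling (k ℕ.∸ suc i)
    rest = applyUpTo (v ∘ (s ℕ.+_)) r
    expands : ∀ {j} → j ℕ.< s → Expands (λ us → F (us ++ rest)) v (upTo s) (T j) (falling (μ j))
    expands {j} j<s ys zs = begin
      F ((ys ++ falling (μ j) ∷ zs) ++ rest)
        ≡⟨ cong F (++-assoc ys (falling (μ j) ∷ zs) rest) ⟩
      F (ys ++ falling (μ j) ∷ zs ++ rest)
        ≡⟨ linear-Σ< A ys (zs ++ rest) (falling (μ j)) k (T j) v (reduce j<s) ⟩
      Σ< k term
        ≡⟨ Σ<-++ s r term ⟩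
      Σ< s term + Σ< r (term ∘ (s ℕ.+_))
        ≡⟨ cong (_+_ (Σ< s term)) (Σ<-zero r vanish) ⟩
      Σ< s term + 0ℤ
        ≡⟨ +-identityʳ (Σ< s term) ⟩
      Σ< s term
        ≡⟨ Σ<-cong s (λ i → cong (λ us → T j i * F us) (++-assoc ys (v i ∷ zs) rest)) ⟨
      Σ< s (λ i → T j i * F ((ys ++ v i ∷ zs) ++ rest))
        ≡⟨ ΣL-applyUpTo _ id s ⟨
      ΣL (upTo s) (λ i → T j i * F ((ys ++ v i ∷ zs) ++ rest)) ∎
      where
      term : ℕ → ℤ
      term i = T j i * F (ys ++ v i ∷ zs ++ rest)
      vanish : ∀ {i} → i ℕ.< r → term (s ℕ.+ i) ≡ 0ℤ
      vanish {i} i<r = trans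
        (cong (T j (s ℕ.+ i) *_)
          (repeated-∈≡0 A ys (∈-++⁺ʳ zs (∈-applyUpTo⁺ (v ∘ (s ℕ.+_)) i<r))))
        (*-zeroʳ (T j (s ℕ.+ i)))

  -- The quotient determinant and its degree

  module _ (s t : ℕ) (lam : Fin s → ℕ) (ε : Fin t → ℕ) where

    ε₀ : ℕ → ℕ
    ε₀ = zeroExtend t ε

    lam₀ : ℕ → ℕ
    lam₀ = zeroExtend s lam

    -- (z)_k modulo the monic polynomial with roots c_1, …, c_k, where k = t + n.
    remainder : ℕ → ℕ → ℤ
    remainder n i = -1ℤ * nodal t ε₀ n t (suc i)

    entry : ℕ → ℕ → ℕ → ℤ
    entry n j i = reduced (remainder n) j (lam₀ j) i

    -- The value `Q(k)` at `k = t + n`, as a determinant whose size `s` does not grow with `k`.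
    quotient : ℕ → ℤ
    quotient n = detL (applyUpTo (entry n) s) (upTo s)

    -- The first `t` nodes are roots of the factors carrying `ε`. A later index is `t + j` with
    -- `j < n`, where `ε` is 0, and its node is a root of the Chu-Vandermonde part.
    nodal-vanishes : ∀ {n k} → t ℕ.+ n ≡ k → ∀ i → combination (nodal t ε₀ n t) (suc k) (cvec t ε k i) ≡ 0ℤ
    nodal-vanishes {n} {k} refl i = trans
      (cong₂ (λ m e → combination (nodal t ε₀ n t) (suc m) (+ (k ℕ.+ toℕ i) - + e))
        (ℕ.+-comm t n) (extend≡zeroExtend t ε k i))
      (cases (toℕ i ℕ.<? t))
      where
      cases : Dec (toℕ i ℕ.< t) →
        combination (nodal t ε₀ n t) (suc (n ℕ.+ t)) (+ (k ℕ.+ toℕ i) - + ε₀ (toℕ i)) ≡ 0ℤ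
      cases (yes i<t) = nodal-vanishes-shifted t ε₀ n t i<t
      cases (no i≮t) with j , t+j≡i ← ℕ.m≤n⇒∃[o]m+o≡n (ℕ.≮⇒≥ i≮t) = trans
        (cong (combination (nodal t ε₀ n t) (suc (n ℕ.+ t))) (trans
          (cong₂ (λ a e → + (k ℕ.+ a) - + e) (sym t+j≡i) (zeroExtend-≥ t ε (ℕ.≮⇒≥ i≮t)))
          (+-identityʳ (+ (k ℕ.+ (t ℕ.+ j))))))
        (nodal-vanishes-unshifted t ε₀ n t
          (ℕ.+-cancelˡ-< t j n (subst (ℕ._< k) (sym t+j≡i) (Fin.toℕ<n i))))

    -- At a node the monic nodal polynomial vanishes, so its leading term `(c)_k` is the negative of
    -- the lower terms.
    descFact-remainder : ∀ {n k} → t ℕ.+ n ≡ k → ∀ i →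
      descFact (cvec t ε k i) k ≡ combination (remainder n) k (cvec t ε k i)
    descFact-remainder {n} {k} eq i = begin
      descFact c k
        ≡⟨ lem (descFact c k) S ⟩
      1ℤ * descFact c k + S + -1ℤ * S
        ≡⟨ cong (λ a → a * descFact c k + S + -1ℤ * S) (nodal-head t ε₀ n t) ⟨
      combination (nodal t ε₀ n t) (suc k) c + -1ℤ * S
        ≡⟨ cong (_+ -1ℤ * S) (nodal-vanishes eq i) ⟩
      0ℤ + -1ℤ * S
        ≡⟨ +-identityˡ (-1ℤ * S) ⟩
      -1ℤ * S
        ≡⟨ Σ<-* k -1ℤ _ ⟨
      Σ< k (λ i → -1ℤ * (nodal t ε₀ n t (suc i) * descFact c (k ℕ.∸ suc i)))
        ≡⟨ Σ<-cong k (λ i → *-assoc -1ℤ (nodal t ε₀ n t (suc i)) (descFact c (k ℕ.∸ suc i))) ⟨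
      combination (remainder n) k c ∎
      where
      c = cvec t ε k i
      S = combination (nodal t ε₀ n t ∘ suc) k c
      lem : ∀ a b → a ≡ 1ℤ * a + b + -1ℤ * b
      lem = ℤ.solve-∀

    remainder-support : ∀ {n k i} → t ℕ.+ n ≡ k → k ℕ.≤ i → remainder n i ≡ 0ℤ
    remainder-support {n} {i = i} refl p = cong (-1ℤ *_)
      (nodal-support t ε₀ n t (s≤s (subst (ℕ._≤ i) (ℕ.+-comm t n) p)))

    Poly-entry : ∀ j i → Poly t (lam₀ j ℕ.+ lam₀ j ℕ.+ (i ℕ.+ i)) (j ℕ.+ j) (λ n → entry n j i)
    Poly-entry j i = Poly-reduced (λ i → Poly-scale {f = λ n → nodal t ε₀ n t (suc i)} -1ℤ (Poly-nodal ε₀ t (suc i))) j (lam₀ j) i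

    Poly-quotient : Poly t (sum (map (λ j → lam₀ j ℕ.+ lam₀ j) (upTo s)) ℕ.+ sum (map (λ i → i ℕ.+ i) (upTo s)))
      (sum (map (λ j → j ℕ.+ j) (upTo s))) quotient
    Poly-quotient = Poly-cong (λ n → cong (λ φs → detL φs (upTo s)) (map-upTo (entry n) s))
      (Poly-detL {φ = λ j n → entry n j} _ (λ j → j ℕ.+ j) (λ i → i ℕ.+ i) Poly-entry (upTo s) (upTo s))

    -- The column weights `2i` and the row offsets `2j` run over the same indices and cancel,
    -- leaving twice the sum of the parts.
    length-bound : suc (sum (map (λ j → lam₀ j ℕ.+ lam₀ j) (upTo s)) ℕ.+ sum (map (λ i → i ℕ.+ i) (upTo s)))
      ℕ.∸ sum (map (λ j → j ℕ.+ j) (upTo s)) ≡ suc (2 ℕ.* sumℕ s lam)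
    length-bound = trans (ℕ.m+n∸n≡m (suc (sum (map (λ j → lam₀ j ℕ.+ lam₀ j) (upTo s)))) (sum (map (λ i → i ℕ.+ i) (upTo s))))
      (cong suc (trans (cong sum (map-upTo (λ j → lam₀ j ℕ.+ lam₀ j) s)) (sum-doubled s lam)))

    det-theMatrix : ∀ {n k r} → t ℕ.+ n ≡ k → s ℕ.+ r ≡ k →
      det k (theMatrix s t lam ε k) ≡ quotient n * (signK k * vandermonde k (cvec t ε k))
    det-theMatrix {n} {k} {r} eq refl = begin
      det k (theMatrix s t lam ε k)
        ≡⟨ det≡detL k (theMatrix s t lam ε k) (eval ∘ c) (falling ∘ μ ∘ toℕ)
             (λ i j → cong (λ m → descFact (c i) (m ℕ.+ (k ℕ.∸ suc (toℕ j)))) (extend≡zeroExtend s lam k j)) ⟩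
      detL (tabulate (eval ∘ c)) (tabulate (falling ∘ μ ∘ toℕ {k}))
        ≡⟨ cong₂ detL (sym (map-tabulate c eval)) (tabulate-toℕ k (λ _ → refl)) ⟩
      detL (map eval (tabulate c)) (applyUpTo (falling ∘ μ) k)
        ≡⟨ detL-columns (tabulate c) s r μ (entry n)
             (λ {j} j<s → All.tabulate⁺ (λ i → descFact-reduced (remainder-support eq) (descFact-remainder eq i)
               (ℕ.≤-trans j<s (ℕ.m≤m+n s r)) (lam₀ j)))
             (λ i → cong (ℕ._+ (k ℕ.∸ suc (s ℕ.+ i))) (zeroExtend-≥ s lam (ℕ.m≤m+n s i))) ⟩
      quotient n * detL (map eval (tabulate c)) (applyUpTo (λ i → falling (k ℕ.∸ suc i)) k)
        ≡⟨ cong (λ us → quotient n * detL (map eval (tabulate c)) us)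
             (trans (sym (fallings≡applyUpTo k)) (cong fallings (sym (length-tabulate c)))) ⟩
      quotient n * detL (map eval (tabulate c)) (fallings (length (tabulate c)))
        ≡⟨ cong (quotient n *_) (trans (detL-fallings (tabulate c)) (alternant≡vandermonde k c)) ⟩
      quotient n * (signK k * vandermonde k c) ∎
      where
      c = cvec t ε k
      μ : ℕ → ℕ
      μ j = lam₀ j ℕ.+ (k ℕ.∸ suc j)

open import Data.Nat using (_≤_; _*_)

theorem4 : (s t : ℕ) (lam : Fin s → ℕ) → (∀ i j → i Fin.≤ j → lam j ≤ lam i)
    → (ε : Fin t → ℕ)
    → Σ (List ℚ) (λ Q → (length Q ≤ suc (2 * sumℕ s lam))
    × (∀ k → s ≤ k → t ≤ k
    → toℚ (det k (theMatrix s t lam ε k))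
    ≡ toℚ (signK k ℤ.* vandermonde k (cvec t ε k)) ℚ.* evalPoly Q (toℚ (+ k))))
theorem4 s t lam _ ε = Q , subst (length Q ≤_) (length-bound s t lam ε) length≤ , identity
  where
  open Poly (Poly-quotient s t lam ε) renaming (coefficients to Q)
  open ≡-Reasoning
  identity : ∀ k → s ≤ k → t ≤ k → toℚ (det k (theMatrix s t lam ε k)) ≡
    toℚ (signK k ℤ.* vandermonde k (cvec t ε k)) ℚ.* evalPoly Q (toℚ (+ k))
  identity k s≤k t≤k = begin
    toℚ (det k (theMatrix s t lam ε k))
      ≡⟨ cong toℚ (det-theMatrix s t lam ε t+n≡k (ℕ.m+[n∸m]≡n s≤k)) ⟩
    toℚ (quotient s t lam ε n ℤ.* V)
      ≡⟨ toℚ-* (quotient s t lam ε n) V ⟩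
    toℚ (quotient s t lam ε n) ℚ.* toℚ V
      ≡⟨ ℚ.*-comm (toℚ (quotient s t lam ε n)) (toℚ V) ⟩
    toℚ V ℚ.* toℚ (quotient s t lam ε n)
      ≡⟨ cong (toℚ V ℚ.*_) (evaluates n) ⟩
    toℚ V ℚ.* evalPoly Q (toℚ (+ (t ℕ.+ n)))
      ≡⟨ cong (λ m → toℚ V ℚ.* evalPoly Q (toℚ (+ m))) t+n≡k ⟩
    toℚ V ℚ.* evalPoly Q (toℚ (+ k)) ∎
    where
    -- The coefficients were handled as functions of `n` with `k = t + n`; `t ≤ k` makes this
    -- subtraction exact.
    n = k ℕ.∸ t
    t+n≡k = ℕ.m+[n∸m]≡n t≤k
    V = signK k ℤ.* vandermonde k (cvec t ε k)
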